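{- Let $\alpha\in\mathbb Z\setminus\{0,1\}$ and let $(h_n)$ be the sequence with $h_0=0$, $h_1=1$, $h_2=-\alpha^3(\alpha-1)(2\alpha-1)$, $h_3=-\alpha^8(\alpha-1)^3(2\alpha-1)^3$, $h_4=\alpha^{14}(\alpha-1)^6(2\alpha-1)^6$, and for $m\ge2$: $h_{2m+1}=h_{m+2}h_m^3-h_{m-1}h_{m+1}^3$, for $m\ge 3$: $h_{2m}=h_m\big(h_{m+2}h_{m-1}^2-h_{m-2}h_{m+1}^2\big)/h_2$. If $n\equiv 2,5,10,11,12,13,14,19,22\pmod{24}$, then $h_n$ is not a cube.
   Context: The sequence defined is the elliptic divisibility sequence attached to the point $(0,0)$ of order $8$ on the curve $y^2+(\alpha-\xi)xy-\alpha^3\xi y=x^3-\alpha^2\xi x^2$ with $\xi=(2\alpha-1)(\alpha-1)$. Convention: an integer $m$ is called a cube if $m=\beta^3$ for some nonzero integer $\beta$. -}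

module Defs where

open import Data.Nat as ℕ using (ℕ)
open import Data.Integer using (ℤ; +_; _+_; _-_; _*_; -_; _^_)
open import Data.Product using (∃-syntax; _×_)
open import Relation.Binary.PropositionalEquality using (_≡_; _≢_)
open import Relation.Nullary using (¬_)

-- ξ = (2α-1)(α-1)
-- h satisfies the defining data of the sequence (h_n) attached to α.
-- The even-index recurrence h_{2m} = h_m (h_{m+2} h_{m-1}^2 - h_{m-2} h_{m+1}^2) / h_2
-- is stated in the equivalent multiplied-out form (h_2 ≠ 0 since α ∉ {0,1}),
-- with m = k + 3 (so m ≥ 3); odd recurrence uses m = k + 2 (so m ≥ 2).
record IsH (α : ℤ) (h : ℕ → ℤ) : Set where
  field
    h0 : h 0 ≡ + 0
    h1 : h 1 ≡ + 1
    h2 : h 2 ≡ - ((α ^ 3) * (α - + 1) * (+ 2 * α - + 1))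
    h3 : h 3 ≡ - ((α ^ 8) * ((α - + 1) ^ 3) * ((+ 2 * α - + 1) ^ 3))
    h4 : h 4 ≡ (α ^ 14) * ((α - + 1) ^ 6) * ((+ 2 * α - + 1) ^ 6)
    hodd : ∀ k → let m = k ℕ.+ 2 in
      h (2 ℕ.* m ℕ.+ 1) ≡ h (m ℕ.+ 2) * (h m ^ 3) - h (m ℕ.∸ 1) * (h (m ℕ.+ 1) ^ 3)
    heven : ∀ k → let m = k ℕ.+ 3 in
      h 2 * h (2 ℕ.* m) ≡
        h m * (h (m ℕ.+ 2) * (h (m ℕ.∸ 1) ^ 2) - h (m ℕ.∸ 2) * (h (m ℕ.+ 1) ^ 2))

IsCube : ℤ → Set
IsCube m = ∃[ β ] (β ≢ + 0 × m ≡ β ^ 3)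

{-# OPTIONS --safe #-}
-- Up to sign, h n is a monomial in the pairwise coprime numbers α, α - 1 and 2 α - 1, and
-- h (n + 8) = - V ^ (n + 4) * h n with V = - α ^ 15 (α - 1) ^ 7 (2 α - 1) ^ 6; this quasi-periodicity
-- reduces the recurrences to finitely many identities between monomials, and makes h n a nonzero
-- cube times h (n % 24). For the listed residues, h (n % 24) is a cube times (α - 1) (2 α - 1),
-- α² (α - 1) or α² (α - 1)². In the last two cases α and α - 1 would be consecutive cubes. In the
-- first, α - 1 = x³ and 2 α - 1 = y³ with y³ - 1 = 2 x³, which is ruled out by Euler's descent for
-- p (p² + 3 q²) = c³, using unique factorisation in ℤ[ω].
module Submission where

open import Algebra.Bundles using (CommutativeRing)
import Algebra.Properties.AbelianGroup
import Algebra.Properties.Ring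
import Algebra.Solver.Ring.NaturalCoefficients.Default
open import Algebra.Structures using (IsCommutativeRing)
open import Data.Empty using (⊥)
open import Data.List using (List; _∷_; [])
open import Data.List.Membership.Propositional using (_∈_)
open import Data.List.Relation.Unary.Any using (here; there)
open import Data.Nat as ℕ using (ℕ; zero; suc; _%_)
import Data.Nat.DivMod as ℕ
open import Data.Nat.Induction using (<-rec; <-wellFounded)
import Data.Nat.Properties as ℕ
import Data.Nat.Tactic.RingSolver as ℕ-Solver
open import Data.Product using (∃-syntax; _×_; _,_; proj₁; proj₂)
open import Data.Sign as Sign using (Sign)
open import Data.Sum using (_⊎_; inj₁; inj₂; [_,_]′)
open import Defs
open import Function using (_∘_; id)
open import Induction.WellFounded using (Acc; acc)
open import Level using (0ℓ; _⊔_)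
import Relation.Binary.Reasoning.Setoid
open import Relation.Nullary using (¬_; yes; no; contradiction)

-- Euclidean rings

-- The factors of p² + 3 q² live in ℤ[√-3], where unique factorisation fails; ℤ[ω] has it, at the
-- price of roots outside ℤ[√-3] and of six units. Powers of ω move any root into ℤ[√-3] without
-- changing its cube, and the oddness of p + q leaves only the units ± 1, which are cubes
-- themselves. Primes never occur: a coprime factor of a cube is recovered from its gcd with the
-- root, by one argument used for both ℤ and ℤ[ω]. The descent starts from y³ + (-1)³ = 2 x³: the
-- half sum p and half difference q of y and -1 satisfy p (p² + 3 q²) = x³. It is q that shrinks; 3
-- | p is a case apart, because p and p² + 3 q² then share the factor 3. The modulus 24 is three
-- quasi-periods: l of them multiply by (-1)^l V^(4 l² + l r), a cube once 3 divides l. The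
-- monomials are checked against the recurrences, and these determine the sequence since h 2 is
-- nonzero.

record Euclidean {c ℓ} (R : CommutativeRing c ℓ) : Set (c ⊔ ℓ) where
  open CommutativeRing R
  field
    size   : Carrier → ℕ
    cancel : ∀ x {y z} → ¬ x ≈ 0# → x * y ≈ x * z → y ≈ z
    divMod : ∀ x y → y ≈ 0# ⊎ (∃[ q ] ∃[ r ] (x ≈ q * y + r × size r ℕ.< size y))

module EuclideanProperties {c ℓ} {R : CommutativeRing c ℓ} (E : Euclidean R) where
  open CommutativeRing R
  open Euclidean E
  open Algebra.Properties.AbelianGroup +-abelianGroup using (xyx⁻¹≈y)
  open Algebra.Properties.Ring ring using (-‿distribˡ-*)
  open Algebra.Solver.Ring.NaturalCoefficients.Default commutativeSemiring
  open Relation.Binary.Reasoning.Setoid setoid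

  -- Being both a combination and a common divisor, `d` generates the ideal of `x` and `y`; this
  -- characterises a gcd without any choice of normal form.
  record Bezout (x y : Carrier) : Set (c ⊔ ℓ) where
    field
      {d s t x′ y′} : Carrier
      combination   : d ≈ s * x + t * y
      divides-x     : x ≈ d * x′
      divides-y     : y ≈ d * y′

  bezout : ∀ x y → Bezout x y
  bezout x y = go x y (<-wellFounded (size y))
    where
    go : ∀ x y → Acc ℕ._<_ (size y) → Bezout x y
    go x y (acc rec) with divMod x y
    ... | inj₁ y≈0 = record
      { d = x ; s = 1# ; t = 0# ; x′ = 1# ; y′ = 0#
      ; combination = solve 2 (λ x y → x := con 1 :* x :+ con 0 :* y) refl x y
      ; divides-x   = sym (*-identityʳ x)
      ; divides-y   = trans y≈0 (sym (zeroʳ x))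
      }
    ... | inj₂ (q , r , x≈qy+r , r<y) = record
      { d = d ; s = t ; t = s + t * - q ; x′ = q * x′ + y′ ; y′ = x′
      ; combination = begin
          d                           ≈⟨ combination ⟩
          s * y + t * r               ≈⟨ +-congˡ (*-congˡ r≈x-qy) ⟩
          s * y + t * (x + - q * y)   ≈⟨ solve 5 (λ s t x y m →
              s :* y :+ t :* (x :+ m :* y) := t :* x :+ (s :+ t :* m) :* y)
              refl s t x y (- q) ⟩
          t * x + (s + t * - q) * y   ∎
      ; divides-x   = begin
          x                           ≈⟨ x≈qy+r ⟩
          q * y + r                   ≈⟨ +-cong (*-congˡ divides-x) divides-y ⟩
          q * (d * x′) + d * y′       ≈⟨ solve 4 (λ q d x y →
              q :* (d :* x) :+ d :* y := d :* (q :* x :+ y)) refl q d x′ y′ ⟩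
          d * (q * x′ + y′)           ∎
      ; divides-y   = divides-x
      }
      where
      open Bezout (go y r (rec r<y))
      r≈x-qy : r ≈ x + - q * y
      r≈x-qy = begin
        r                     ≈⟨ xyx⁻¹≈y (q * y) r ⟨
        q * y + r + - (q * y) ≈⟨ +-cong (sym x≈qy+r) (-‿distribˡ-* q y) ⟩
        x + - q * y           ∎

  -- With (d) = (u , w), the cube of the ideal (u , w) is u · (u² , uw , w² , v) = (u).
  coprime-factor-of-cube : ∀ {u v w p q} → ¬ u ≈ 0# → p * u + q * v ≈ 1# → u * v ≈ w * w * w →
    ∃[ d ] ∃[ f ] ∃[ e ] (u ≈ f * (d * d * d) × e * f ≈ 1#)
  coprime-factor-of-cube {u} {v} {w} {p} {q} u≉0 pu+qv≈1 uv≈w³ = d , f , e , u≈fd³ , ef≈1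
    where
    open Bezout (bezout u w) renaming (x′ to u′; y′ to w′; divides-x to u≈du′; divides-y to w≈dw′)
    -- `P` and `Q` are the coefficients of `u³` and `u v` in `u (p u + q v)²`. As `u v = w³`, this
    -- writes `u` through two cubes divisible by `d³`.
    P = p * p
    Q = (1# + 1#) * p * u * q + q * q * v
    f = P * (u′ * u′ * u′) + Q * (w′ * w′ * w′)
    -- The cofactor of `u` in `(s u + t w)³ = d³` once `w³` is replaced by `u v`; together with
    -- `u = f d³` it makes `f` a unit.
    e = s * s * s * u * u + (1# + 1# + 1#) * (s * s * t * u * w + s * t * t * w * w) + t * t * t * v

    cube-cong : ∀ {x y} → x ≈ y → x * x * x ≈ y * y * y
    cube-cong eq = *-cong (*-cong eq eq) eq

    u≈fd³ : u ≈ f * (d * d * d)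
    u≈fd³ = begin
      u                                     ≈⟨ *-identityʳ u ⟨
      u * 1#                                ≈⟨ *-congˡ (*-identityʳ 1#) ⟨
      u * (1# * 1#)                         ≈⟨ *-congˡ (*-cong pu+qv≈1 pu+qv≈1) ⟨
      u * ((p * u + q * v) * (p * u + q * v)) ≈⟨ solve 4 (λ u v p q →
          u :* ((p :* u :+ q :* v) :* (p :* u :+ q :* v)) :=
          p :* p :* (u :* u :* u) :+ ((con 1 :+ con 1) :* p :* u :* q :+ q :* q :* v) :* (u :* v))
          refl u v p q ⟩
      P * (u * u * u) + Q * (u * v)         ≈⟨ +-congˡ (*-congˡ uv≈w³) ⟩
      P * (u * u * u) + Q * (w * w * w)     ≈⟨ +-cong (*-congˡ (cube-cong u≈du′)) (*-congˡ (cube-cong w≈dw′)) ⟩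
      P * (d * u′ * (d * u′) * (d * u′)) + Q * (d * w′ * (d * w′) * (d * w′)) ≈⟨ solve 5 (λ P Q d u w →
          P :* (d :* u :* (d :* u) :* (d :* u)) :+ Q :* (d :* w :* (d :* w) :* (d :* w)) :=
          (P :* (u :* u :* u) :+ Q :* (w :* w :* w)) :* (d :* d :* d)) refl P Q d u′ w′ ⟩
      f * (d * d * d)                       ∎

    d³≈ue : d * d * d ≈ u * e
    d³≈ue = begin
      d * d * d                                                 ≈⟨ cube-cong combination ⟩
      (s * u + t * w) * (s * u + t * w) * (s * u + t * w)       ≈⟨ solve 4 (λ s t u w →
          (s :* u :+ t :* w) :* (s :* u :+ t :* w) :* (s :* u :+ t :* w) :=
          u :* (s :* s :* s :* u :* u :+ (con 1 :+ con 1 :+ con 1) :*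
            (s :* s :* t :* u :* w :+ s :* t :* t :* w :* w)) :+ t :* t :* t :* (w :* w :* w))
          refl s t u w ⟩
      u * e₀ + t * t * t * (w * w * w)                          ≈⟨ +-congˡ (*-congˡ uv≈w³) ⟨
      u * e₀ + t * t * t * (u * v)                              ≈⟨ solve 4 (λ u x t v →
          u :* x :+ t :* (u :* v) := u :* (x :+ t :* v)) refl u e₀ (t * t * t) v ⟩
      u * e                                                     ∎
      where e₀ = s * s * s * u * u + (1# + 1# + 1#) * (s * s * t * u * w + s * t * t * w * w)

    ef≈1 : e * f ≈ 1#
    ef≈1 = cancel u u≉0 (begin
      u * (e * f)     ≈⟨ *-assoc u e f ⟨
      u * e * f       ≈⟨ *-congʳ d³≈ue ⟨
      d * d * d * f   ≈⟨ *-comm (d * d * d) f ⟩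
      f * (d * d * d) ≈⟨ u≈fd³ ⟨
      u               ≈⟨ *-identityʳ u ⟨
      u * 1#          ∎)

  -- Dividing `x` and `y` by their gcd gives `u x′³ = y′³` with `x′` and `y′` coprime. Then `x′`
  -- divides both `y′³` and `x′`, so it is a unit, and `u` is the cube of `y′ / x′`.
  cube-quotient : ∀ {u x y} → ¬ x ≈ 0# → u * (x * x * x) ≈ y * y * y → ∃[ z ] (u ≈ z * z * z)
  cube-quotient {u} {x} {y} x≉0 ux³≈y³ = y′ * e , (begin
    u                                       ≈⟨ solve 1 (λ u → u := u :* (con 1 :* con 1 :* con 1)) refl u ⟩
    u * (1# * 1# * 1#)                      ≈⟨ *-congˡ (*-cong (*-cong x′e≈1 x′e≈1) x′e≈1) ⟨
    u * (x′ * e * (x′ * e) * (x′ * e))      ≈⟨ solve 3 (λ u x e →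
        u :* (x :* e :* (x :* e) :* (x :* e)) := u :* (x :* x :* x) :* (e :* e :* e)) refl u x′ e ⟩
    u * (x′ * x′ * x′) * (e * e * e)        ≈⟨ *-congʳ ux′³≈y′³ ⟩
    y′ * y′ * y′ * (e * e * e)              ≈⟨ solve 2 (λ y e →
        y :* y :* y :* (e :* e :* e) := y :* e :* (y :* e) :* (y :* e)) refl y′ e ⟩
    y′ * e * (y′ * e) * (y′ * e)            ∎)
    where
    open Bezout (bezout x y)
    e₀ = s * s * s * x′ * x′ + (1# + 1# + 1#) * (s * s * t * x′ * y′ + s * t * t * y′ * y′)
    -- The cofactor of `x′` in `(s x′ + t y′)³ = 1` once `y′³` is replaced by `u x′³`, hence the
    -- inverse of `x′`.
    e  = e₀ + t * t * t * (u * (x′ * x′))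

    d≉0 : ¬ d ≈ 0#
    d≉0 d≈0 = x≉0 (trans divides-x (trans (*-congʳ d≈0) (zeroˡ x′)))

    sx′+ty′≈1 : s * x′ + t * y′ ≈ 1#
    sx′+ty′≈1 = cancel d d≉0 (begin
      d * (s * x′ + t * y′)         ≈⟨ solve 5 (λ d s t x y →
          d :* (s :* x :+ t :* y) := s :* (d :* x) :+ t :* (d :* y)) refl d s t x′ y′ ⟩
      s * (d * x′) + t * (d * y′)   ≈⟨ +-cong (*-congˡ divides-x) (*-congˡ divides-y) ⟨
      s * x + t * y                 ≈⟨ combination ⟨
      d                             ≈⟨ *-identityʳ d ⟨
      d * 1#                        ∎)

    ux′³≈y′³ : u * (x′ * x′ * x′) ≈ y′ * y′ * y′
    ux′³≈y′³ = cancel d d≉0 (cancel d d≉0 (cancel d d≉0 (begin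
      d * (d * (d * (u * (x′ * x′ * x′))))        ≈⟨ solve 3 (λ d u x →
          d :* (d :* (d :* (u :* (x :* x :* x)))) := u :* (d :* x :* (d :* x) :* (d :* x))) refl d u x′ ⟩
      u * (d * x′ * (d * x′) * (d * x′))          ≈⟨ *-congˡ (*-cong (*-cong divides-x divides-x) divides-x) ⟨
      u * (x * x * x)                             ≈⟨ ux³≈y³ ⟩
      y * y * y                                   ≈⟨ *-cong (*-cong divides-y divides-y) divides-y ⟩
      d * y′ * (d * y′) * (d * y′)                ≈⟨ solve 2 (λ d y →
          d :* y :* (d :* y) :* (d :* y) := d :* (d :* (d :* (y :* y :* y)))) refl d y′ ⟩
      d * (d * (d * (y′ * y′ * y′)))              ∎)))

    x′e≈1 : x′ * e ≈ 1#
    x′e≈1 = begin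
      x′ * e                                      ≈⟨ solve 4 (λ x a t u →
          x :* (a :+ t :* (u :* (x :* x))) := x :* a :+ t :* (u :* (x :* x :* x))) refl x′ e₀ (t * t * t) u ⟩
      x′ * e₀ + t * t * t * (u * (x′ * x′ * x′))  ≈⟨ +-congˡ (*-congˡ ux′³≈y′³) ⟩
      x′ * e₀ + t * t * t * (y′ * y′ * y′)        ≈⟨ solve 4 (λ s t x y →
          x :* (s :* s :* s :* x :* x :+ (con 1 :+ con 1 :+ con 1) :*
            (s :* s :* t :* x :* y :+ s :* t :* t :* y :* y)) :+ t :* t :* t :* (y :* y :* y) :=
          (s :* x :+ t :* y) :* (s :* x :+ t :* y) :* (s :* x :+ t :* y)) refl s t x′ y′ ⟩
      (s * x′ + t * y′) * (s * x′ + t * y′) * (s * x′ + t * y′)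
                                                  ≈⟨ *-cong (*-cong sx′+ty′≈1 sx′+ty′≈1) sx′+ty′≈1 ⟩
      1# * 1# * 1#                                ≈⟨ trans (*-identityʳ _) (*-identityʳ 1#) ⟩
      1#                                          ∎

-- Integer arithmetic: Euclidean division and parity

open import Data.Integer as ℤ using (ℤ; +_; -[1+_]; ∣_∣; _+_; _-_; _*_; -_; _^_)
open import Data.Integer.DivMod using (_%ℕ_; _/ℕ_; n%ℕd<d; a≡a%ℕn+[a/ℕn]*n)
import Data.Integer.DivMod as ℤ
import Data.Integer.Properties as ℤ
import Data.Integer.Solver
open import Data.Integer.Tactic.RingSolver using (solve; solve-∀)
open import Relation.Binary.PropositionalEquality

-- The last argument is an identity of commutative rings, left to the solver.
linear : ∀ {x y l r} c → l ≡ r → x - y ≡ c * (l - r) → x ≡ y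
linear {x} {y} {l} c refl eq = ℤ.i-j≡0⇒i≡j x y (trans eq (trans (cong (c *_) (ℤ.+-inverseʳ l)) (ℤ.*-zeroʳ c)))

linear₂ : ∀ {x y l r l′ r′} c c′ → l ≡ r → l′ ≡ r′ → x - y ≡ c * (l - r) + c′ * (l′ - r′) → x ≡ y
linear₂ {x} {y} {l} {r} {l′} {r′} c c′ refl eq′ eq = linear c′ eq′
  (trans eq (trans (cong (_+ c′ * (l′ - r′)) (trans (cong (c *_) (ℤ.+-inverseʳ l)) (ℤ.*-zeroʳ c))) (ℤ.+-identityˡ _)))

n²≡∣n∣² : ∀ n → n * n ≡ + (∣ n ∣ ℕ.* ∣ n ∣)
n²≡∣n∣² (+ n)    = sym (ℤ.pos-* n n)
n²≡∣n∣² -[1+ n ] = refl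

mult-cancelˡ : ∀ x {y z} → x ≢ + 0 → x * y ≡ x * z → y ≡ z
mult-cancelˡ x {y} {z} x≢0 = ℤ.*-cancelˡ-≡ x y z {{ℤ.≢-nonZero x≢0}}

*-≢0 : ∀ {x y} → x ≢ + 0 → y ≢ + 0 → x * y ≢ + 0
*-≢0 {x} {y} x≢0 y≢0 xy≡0 with ℤ.i*j≡0⇒i≡0∨j≡0 x xy≡0
... | inj₁ x≡0 = x≢0 x≡0
... | inj₂ y≡0 = y≢0 y≡0

ℤ-euclidean : Euclidean ℤ.+-*-commutativeRing
ℤ-euclidean = record
  { size   = ∣_∣
  ; cancel = mult-cancelˡ
  ; divMod = divMod
  }
  where
  divMod : ∀ x y → y ≡ + 0 ⊎ (∃[ q ] ∃[ r ] (x ≡ q * y + r × ∣ r ∣ ℕ.< ∣ y ∣))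
  divMod x y with y ℤ.≟ + 0
  ... | yes y≡0 = inj₁ y≡0
  ... | no  y≢0 = inj₂ (x ℤ./ y , + (x ℤ.% y) ,
      trans (ℤ.a≡a%n+[a/n]*n x y) (ℤ.+-comm (+ (x ℤ.% y)) (x ℤ./ y * y)) , ℤ.n%d<d x y)
    where instance _ = ℤ.≢-nonZero y≢0

Even Odd : ℤ → Set
Even n = ∃[ k ] n ≡ + 2 * k
Odd  n = ∃[ k ] n ≡ + 2 * k + + 1

parity : ∀ n → Even n ⊎ Odd n
parity n = cases (n %ℕ 2) (n /ℕ 2) (n%ℕd<d n 2) (a≡a%ℕn+[a/ℕn]*n n 2)
  where
  cases : ∀ r k → r ℕ.< 2 → n ≡ + r + k * + 2 → Even n ⊎ Odd n
  cases 0 k _ eq = inj₁ (k , linear (+ 1) eq (solve (n ∷ k ∷ [])))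
  cases 1 k _ eq = inj₂ (k , linear (+ 1) eq (solve (n ∷ k ∷ [])))
  cases (suc (suc _)) k (ℕ.s≤s (ℕ.s≤s ()))

even-odd-disjoint : ∀ {n} → Even n → Odd n → ⊥
even-odd-disjoint {n} (k , n≡2k) (l , n≡2l+1) = impossible (k - l) (linear₂ (+ 1) (- + 1) n≡2l+1 n≡2k (solve (n ∷ k ∷ l ∷ [])))
  where
  impossible : ∀ m → + 2 * m ≢ + 1
  impossible (+ zero)         ()
  impossible (+ suc zero)     ()
  impossible (+ suc (suc m))  ()
  impossible -[1+ m ]         ()

odd-factorʳ : ∀ m {n} → Odd (m * n) → Odd n
odd-factorʳ m {n} odd = [ (λ even → contradiction odd (even-odd-disjoint (even-multiple even))) , id ]′ (parity n)
  where
  even-multiple : Even n → Even (m * n)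
  even-multiple (k , n≡2k) = m * k , linear m n≡2k (solve (m ∷ n ∷ k ∷ []))

odd-≢0 : ∀ {n} → Odd n → n ≢ + 0
odd-≢0 odd refl = even-odd-disjoint (+ 0 , refl) odd

-- The ring ℤ[ω]

-- ⟨ a , b ⟩ is a + b ω with ω² + ω + 1 = 0.
record ℤ[ω] : Set where
  constructor ⟨_,_⟩
  field
    re im : ℤ

open ℤ[ω]

infixl 6 _⊕_
infixl 7 _⊗_

_⊕_ _⊗_ : ℤ[ω] → ℤ[ω] → ℤ[ω]
⟨ a , b ⟩ ⊕ ⟨ c , d ⟩ = ⟨ a + c , b + d ⟩
⟨ a , b ⟩ ⊗ ⟨ c , d ⟩ = ⟨ a * c - b * d , a * d + b * c - b * d ⟩

⊖_ : ℤ[ω] → ℤ[ω]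
⊖ ⟨ a , b ⟩ = ⟨ - a , - b ⟩

norm : ℤ[ω] → ℤ
norm ⟨ a , b ⟩ = a * a - a * b + b * b

conjugate : ℤ[ω] → ℤ[ω]
conjugate ⟨ a , b ⟩ = ⟨ a - b , - b ⟩

open Data.Integer.Solver.+-*-Solver using (Polynomial; _:=_; _:+_; _:*_; _:-_; :-_; con) renaming (solve to solveₚ)

-- The operations of ℤ[ω] on polynomial expressions, for stating identities to the ring solver.
infixl 6 _⊕ₚ_
infixl 7 _⊗ₚ_

_⊕ₚ_ _⊗ₚ_ : ∀ {n} → Polynomial n × Polynomial n → Polynomial n × Polynomial n → Polynomial n × Polynomial n
(a , b) ⊕ₚ (c , d) = a :+ c , b :+ d
(a , b) ⊗ₚ (c , d) = a :* c :- b :* d , a :* d :+ b :* c :- b :* d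

normₚ : ∀ {n} → Polynomial n × Polynomial n → Polynomial n
normₚ (a , b) = a :* a :- a :* b :+ b :* b

conjugateₚ : ∀ {n} → Polynomial n × Polynomial n → Polynomial n × Polynomial n
conjugateₚ (a , b) = a :- b , :- b

cubeₚ : ∀ {n} → Polynomial n × Polynomial n → Polynomial n × Polynomial n
cubeₚ x = x ⊗ₚ x ⊗ₚ x

⊗-assoc : ∀ x y z → (x ⊗ y) ⊗ z ≡ x ⊗ (y ⊗ z)
⊗-assoc ⟨ a , b ⟩ ⟨ c , d ⟩ ⟨ e , f ⟩ = cong₂ ⟨_,_⟩
  (solveₚ 6 (λ a b c d e f → proj₁ (lhs a b c d e f) := proj₁ (rhs a b c d e f)) refl a b c d e f)
  (solveₚ 6 (λ a b c d e f → proj₂ (lhs a b c d e f) := proj₂ (rhs a b c d e f)) refl a b c d e f)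
  where
  lhs rhs : (a b c d e f : Polynomial 6) → Polynomial 6 × Polynomial 6
  lhs a b c d e f = ((a , b) ⊗ₚ (c , d)) ⊗ₚ (e , f)
  rhs a b c d e f = (a , b) ⊗ₚ ((c , d) ⊗ₚ (e , f))

⊗-comm : ∀ x y → x ⊗ y ≡ y ⊗ x
⊗-comm ⟨ a , b ⟩ ⟨ c , d ⟩ = cong₂ ⟨_,_⟩ (solve (a ∷ b ∷ c ∷ d ∷ [])) (solve (a ∷ b ∷ c ∷ d ∷ []))

⊗-identityˡ : ∀ x → ⟨ + 1 , + 0 ⟩ ⊗ x ≡ x
⊗-identityˡ ⟨ a , b ⟩ = cong₂ ⟨_,_⟩ (solve (a ∷ b ∷ [])) (solve (a ∷ b ∷ []))

⊗-distribˡ-⊕ : ∀ x y z → x ⊗ (y ⊕ z) ≡ x ⊗ y ⊕ x ⊗ z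
⊗-distribˡ-⊕ ⟨ a , b ⟩ ⟨ c , d ⟩ ⟨ e , f ⟩ = cong₂ ⟨_,_⟩
  (solveₚ 6 (λ a b c d e f → proj₁ (lhs a b c d e f) := proj₁ (rhs a b c d e f)) refl a b c d e f)
  (solveₚ 6 (λ a b c d e f → proj₂ (lhs a b c d e f) := proj₂ (rhs a b c d e f)) refl a b c d e f)
  where
  lhs rhs : (a b c d e f : Polynomial 6) → Polynomial 6 × Polynomial 6
  lhs a b c d e f = (a , b) ⊗ₚ ((c , d) ⊕ₚ (e , f))
  rhs a b c d e f = (a , b) ⊗ₚ (c , d) ⊕ₚ (a , b) ⊗ₚ (e , f)

⊗-distribʳ-⊕ : ∀ x y z → (y ⊕ z) ⊗ x ≡ y ⊗ x ⊕ z ⊗ x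
⊗-distribʳ-⊕ x y z = trans (⊗-comm (y ⊕ z) x) (trans (⊗-distribˡ-⊕ x y z) (cong₂ _⊕_ (⊗-comm x y) (⊗-comm x z)))

ℤ[ω]-isCommutativeRing : IsCommutativeRing _≡_ _⊕_ _⊗_ ⊖_ ⟨ + 0 , + 0 ⟩ ⟨ + 1 , + 0 ⟩
ℤ[ω]-isCommutativeRing = record
  { isRing = record
    { +-isAbelianGroup = record
      { isGroup = record
        { isMonoid = record
          { isSemigroup = record
            { isMagma = record { isEquivalence = isEquivalence ; ∙-cong = cong₂ _⊕_ }
            ; assoc   = λ x y z → cong₂ ⟨_,_⟩ (ℤ.+-assoc (re x) (re y) (re z)) (ℤ.+-assoc (im x) (im y) (im z))
            }
          ; identity = (λ x → cong₂ ⟨_,_⟩ (ℤ.+-identityˡ (re x)) (ℤ.+-identityˡ (im x)))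
                     , (λ x → cong₂ ⟨_,_⟩ (ℤ.+-identityʳ (re x)) (ℤ.+-identityʳ (im x)))
          }
        ; inverse = (λ x → cong₂ ⟨_,_⟩ (ℤ.+-inverseˡ (re x)) (ℤ.+-inverseˡ (im x)))
                  , (λ x → cong₂ ⟨_,_⟩ (ℤ.+-inverseʳ (re x)) (ℤ.+-inverseʳ (im x)))
        ; ⁻¹-cong = cong ⊖_
        }
      ; comm = λ x y → cong₂ ⟨_,_⟩ (ℤ.+-comm (re x) (re y)) (ℤ.+-comm (im x) (im y))
      }
    ; *-cong     = cong₂ _⊗_
    ; *-assoc    = ⊗-assoc
    ; *-identity = ⊗-identityˡ , λ x → trans (⊗-comm x _) (⊗-identityˡ x)
    ; distrib    = ⊗-distribˡ-⊕ , ⊗-distribʳ-⊕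
    }
  ; *-comm = ⊗-comm
  }

ℤ[ω]-commutativeRing : CommutativeRing 0ℓ 0ℓ
ℤ[ω]-commutativeRing = record { isCommutativeRing = ℤ[ω]-isCommutativeRing }

norm-⊗ : ∀ x y → norm (x ⊗ y) ≡ norm x * norm y
norm-⊗ ⟨ a , b ⟩ ⟨ c , d ⟩ = solveₚ 4 (λ a b c d →
  normₚ ((a , b) ⊗ₚ (c , d)) := normₚ (a , b) :* normₚ (c , d)) refl a b c d

norm-conjugate : ∀ x → norm (conjugate x) ≡ norm x
norm-conjugate ⟨ a , b ⟩ = solveₚ 2 (λ a b → normₚ (conjugateₚ (a , b)) := normₚ (a , b)) refl a b

conjugate-⊗ : ∀ x → x ⊗ conjugate x ≡ ⟨ norm x , + 0 ⟩
conjugate-⊗ ⟨ a , b ⟩ = cong₂ ⟨_,_⟩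
  (solveₚ 2 (λ a b → proj₁ ((a , b) ⊗ₚ conjugateₚ (a , b)) := normₚ (a , b)) refl a b)
  (solveₚ 2 (λ a b → proj₂ ((a , b) ⊗ₚ conjugateₚ (a , b)) := con (+ 0)) refl a b)

n²+3m² : ∀ n m → n * n + + 3 * (m * m) ≡ + (∣ n ∣ ℕ.* ∣ n ∣ ℕ.+ 3 ℕ.* (∣ m ∣ ℕ.* ∣ m ∣))
n²+3m² n m = trans (cong₂ (λ x y → x + + 3 * y) (n²≡∣n∣² n) (n²≡∣n∣² m))
  (cong (λ k → + (∣ n ∣ ℕ.* ∣ n ∣) + k) (sym (ℤ.pos-* 3 (∣ m ∣ ℕ.* ∣ m ∣))))

-- Completing the square. The right side is a natural number and a sum of two squares with positive
-- weights, which yields both the sign and the definiteness of the norm.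
4norm : ∀ x → + 4 * norm x ≡ + (∣ + 2 * re x - im x ∣ ℕ.* ∣ + 2 * re x - im x ∣ ℕ.+ 3 ℕ.* (∣ im x ∣ ℕ.* ∣ im x ∣))
4norm ⟨ a , b ⟩ = trans (identity a b) (n²+3m² (+ 2 * a - b) b)
  where
  identity : ∀ a b → + 4 * (a * a - a * b + b * b) ≡ (+ 2 * a - b) * (+ 2 * a - b) + + 3 * (b * b)
  identity = solve-∀

norm≡∣norm∣ : ∀ x → norm x ≡ + ∣ norm x ∣
norm≡∣norm∣ x with norm x | 4norm x
... | + n      | _  = refl
... | -[1+ n ] | ()

n*n≡0⇒n≡0 : ∀ n → n ℕ.* n ≡ 0 → n ≡ 0
n*n≡0⇒n≡0 zero _ = refl

norm≡0 : ∀ x → norm x ≡ + 0 → x ≡ ⟨ + 0 , + 0 ⟩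
norm≡0 ⟨ a , b ⟩ N≡0 = cong₂ ⟨_,_⟩ a≡0 b≡0
  where
  m = ∣ + 2 * a - b ∣
  sum≡0 : m ℕ.* m ℕ.+ 3 ℕ.* (∣ b ∣ ℕ.* ∣ b ∣) ≡ 0
  sum≡0 = ℤ.+-injective (trans (sym (4norm ⟨ a , b ⟩)) (cong (λ N → + 4 * N) N≡0))
  b≡0 : b ≡ + 0
  b≡0 = ℤ.∣i∣≡0⇒i≡0 (n*n≡0⇒n≡0 ∣ b ∣ (ℕ.m+n≡0⇒m≡0 _ (ℕ.m+n≡0⇒n≡0 (m ℕ.* m) sum≡0)))
  2a-b≡0 : + 2 * a - b ≡ + 0
  2a-b≡0 = ℤ.∣i∣≡0⇒i≡0 (n*n≡0⇒n≡0 m (ℕ.m+n≡0⇒m≡0 _ sum≡0))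
  a≡0 : a ≡ + 0
  a≡0 = mult-cancelˡ (+ 2) (λ ()) (linear₂ (+ 1) (+ 1) 2a-b≡0 b≡0 (solve (a ∷ b ∷ [])))

-- Writing the larger coordinate as `e + g` turns the norm into `e² + e g + g²`, a natural number
-- free of subtraction that falls short of `(e + g)²` by `e g`.
norm-≤-square : ∀ e g → ∣ + e * + e - + e * + (e ℕ.+ g) + + (e ℕ.+ g) * + (e ℕ.+ g) ∣ ℕ.≤ (e ℕ.+ g) ℕ.* (e ℕ.+ g)
norm-≤-square e g = ℕ.≤-trans (ℕ.≤-reflexive (cong ∣_∣ value)) bound
  where
  identity : ∀ e g → e * e - e * (e + g) + (e + g) * (e + g) ≡ e * e + e * g + g * g
  identity = solve-∀
  value : + e * + e - + e * + (e ℕ.+ g) + + (e ℕ.+ g) * + (e ℕ.+ g) ≡ + (e ℕ.* e ℕ.+ e ℕ.* g ℕ.+ g ℕ.* g)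
  value = trans (identity (+ e) (+ g)) (sym (cong₂ _+_ (cong₂ _+_ (ℤ.pos-* e e) (ℤ.pos-* e g)) (ℤ.pos-* g g)))
  expand : ∀ e g → (e ℕ.+ g) ℕ.* (e ℕ.+ g) ≡ (e ℕ.* e ℕ.+ e ℕ.* g ℕ.+ g ℕ.* g) ℕ.+ e ℕ.* g
  expand = ℕ-Solver.solve-∀
  bound : e ℕ.* e ℕ.+ e ℕ.* g ℕ.+ g ℕ.* g ℕ.≤ (e ℕ.+ g) ℕ.* (e ℕ.+ g)
  bound = ℕ.≤-trans (ℕ.m≤m+n _ (e ℕ.* g)) (ℕ.≤-reflexive (sym (expand e g)))

norm-<-ordered : ∀ {e f n} → e ℕ.≤ f → f ℕ.< n → ∣ + e * + e - + e * + f + + f * + f ∣ ℕ.< n ℕ.* n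
norm-<-ordered {e} {f} e≤f f<n = ℕ.≤-<-trans
  (subst (λ k → ∣ + e * + e - + e * + k + + k * + k ∣ ℕ.≤ k ℕ.* k) (ℕ.m+[n∸m]≡n e≤f) (norm-≤-square e (f ℕ.∸ e)))
  (ℕ.*-mono-< f<n f<n)

norm-< : ∀ {e f n} → e ℕ.< n → f ℕ.< n → ∣ norm ⟨ + e , + f ⟩ ∣ ℕ.< n ℕ.* n
norm-< {e} {f} {n} e<n f<n with ℕ.≤-total e f
... | inj₁ e≤f = norm-<-ordered e≤f f<n
... | inj₂ f≤e = subst (λ k → ∣ k ∣ ℕ.< n ℕ.* n) (swap (+ e) (+ f)) (norm-<-ordered f≤e e<n)
  where
  swap : ∀ e f → f * f - f * e + e * e ≡ e * e - e * f + f * f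
  swap = solve-∀

-- Rounding both coordinates of x / y downwards is enough, as a² - a b + b² < 1 on the square 0 ≤ a, b < 1.
ℤ[ω]-euclidean : Euclidean ℤ[ω]-commutativeRing
ℤ[ω]-euclidean = record
  { size   = size
  ; cancel = cancel
  ; divMod = divMod
  }
  where
  size : ℤ[ω] → ℕ
  size x = ∣ norm x ∣

  scale-injective : ∀ {n y z} → n ≢ + 0 → ⟨ n , + 0 ⟩ ⊗ y ≡ ⟨ n , + 0 ⟩ ⊗ z → y ≡ z
  scale-injective {n} {⟨ a , b ⟩} {⟨ c , d ⟩} n≢0 eq = cong₂ ⟨_,_⟩
    (mult-cancelˡ n n≢0 (linear (+ 1) eq-re (solve (n ∷ a ∷ b ∷ c ∷ d ∷ []))))
    (mult-cancelˡ n n≢0 (linear (+ 1) eq-im (solve (n ∷ a ∷ b ∷ c ∷ d ∷ []))))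
    where
    eq-re : n * a - + 0 * b ≡ n * c - + 0 * d
    eq-re = cong re eq
    eq-im : n * b + + 0 * a - + 0 * b ≡ n * d + + 0 * c - + 0 * d
    eq-im = cong im eq

  cancel : ∀ x {y z} → x ≢ ⟨ + 0 , + 0 ⟩ → x ⊗ y ≡ x ⊗ z → y ≡ z
  cancel x {y} {z} x≢0 eq = scale-injective (λ N≡0 → x≢0 (norm≡0 x N≡0)) (begin
    ⟨ norm x , + 0 ⟩ ⊗ y      ≡⟨ cong (_⊗ y) (conj x) ⟨
    (conjugate x ⊗ x) ⊗ y     ≡⟨ ⊗-assoc (conjugate x) x y ⟩
    conjugate x ⊗ (x ⊗ y)     ≡⟨ cong (conjugate x ⊗_) eq ⟩
    conjugate x ⊗ (x ⊗ z)     ≡⟨ ⊗-assoc (conjugate x) x z ⟨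
    (conjugate x ⊗ x) ⊗ z     ≡⟨ cong (_⊗ z) (conj x) ⟩
    ⟨ norm x , + 0 ⟩ ⊗ z      ∎)
    where
    open ≡-Reasoning
    conj : ∀ x → conjugate x ⊗ x ≡ ⟨ norm x , + 0 ⟩
    conj x = trans (⊗-comm (conjugate x) x) (conjugate-⊗ x)

  divMod : ∀ x y → y ≡ ⟨ + 0 , + 0 ⟩ ⊎ (∃[ q ] ∃[ r ] (x ≡ q ⊗ y ⊕ r × size r ℕ.< size y))
  divMod x y with norm y ℤ.≟ + 0
  ... | yes N≡0 = inj₁ (norm≡0 y N≡0)
  ... | no  N≢0 = inj₂ (q , x ⊕ ⊖ (q ⊗ y) , x≡qy+r x (q ⊗ y) , ℕ.*-cancelʳ-< (size y) _ _ (subst (ℕ._< size y ℕ.* size y) size-r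
                      (norm-< (n%ℕd<d (re z) (size y)) (n%ℕd<d (im z) (size y)))))
    where
    instance _ = ℕ.≢-nonZero (λ eq → N≢0 (ℤ.∣i∣≡0⇒i≡0 eq))
    -- `x / y` is `z / norm y`, so rounding means dividing the coordinates of `z` by `norm y`. The
    -- remainders form `e = r ȳ` for the remainder `r` of `x`, whence
    -- `norm r * norm y = norm e < (norm y)²`.
    z = x ⊗ conjugate y
    q = ⟨ re z /ℕ size y , im z /ℕ size y ⟩
    e = ⟨ + (re z %ℕ size y) , + (im z %ℕ size y) ⟩

    x≡qy+r : ∀ x s → x ≡ s ⊕ (x ⊕ ⊖ s)
    x≡qy+r ⟨ a , b ⟩ ⟨ c , d ⟩ = cong₂ ⟨_,_⟩ (i≡j+[i-j] a c) (i≡j+[i-j] b d)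
      where
      i≡j+[i-j] : ∀ i j → i ≡ j + (i - j)
      i≡j+[i-j] = solve-∀

    expand : ∀ x q y → (x ⊕ ⊖ (q ⊗ y)) ⊗ conjugate y ≡ x ⊗ conjugate y ⊕ ⊖ ⟨ re q * norm y , im q * norm y ⟩
    expand ⟨ a , b ⟩ ⟨ c , d ⟩ ⟨ g , h ⟩ = cong₂ ⟨_,_⟩
      (solveₚ 6 (λ a b c d g h → proj₁ (lhs a b c d g h) :=
        proj₁ ((a , b) ⊗ₚ conjugateₚ (g , h)) :+ :- (c :* normₚ (g , h))) refl a b c d g h)
      (solveₚ 6 (λ a b c d g h → proj₂ (lhs a b c d g h) :=
        proj₂ ((a , b) ⊗ₚ conjugateₚ (g , h)) :+ :- (d :* normₚ (g , h))) refl a b c d g h)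
      where
      lhs : (a b c d g h : Polynomial 6) → Polynomial 6 × Polynomial 6
      lhs a b c d g h = (a :+ :- proj₁ qy , b :+ :- proj₂ qy) ⊗ₚ conjugateₚ (g , h)
        where qy = (c , d) ⊗ₚ (g , h)

    remainder : ∀ n → n - (n /ℕ size y) * norm y ≡ + (n %ℕ size y)
    remainder n = trans (cong (λ N → n - (n /ℕ size y) * N) (norm≡∣norm∣ y))
      (rearrange n (+ (n %ℕ size y)) (n /ℕ size y) (+ size y) (a≡a%ℕn+[a/ℕn]*n n (size y)))
      where
      rearrange : ∀ n r q d → n ≡ r + q * d → n - q * d ≡ r
      rearrange n r q d eq = linear (+ 1) eq (solve (n ∷ r ∷ q ∷ d ∷ []))

    rȳ≡e : (x ⊕ ⊖ (q ⊗ y)) ⊗ conjugate y ≡ e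
    rȳ≡e = trans (expand x q y) (cong₂ ⟨_,_⟩ (remainder (re z)) (remainder (im z)))

    size-r : ∣ norm e ∣ ≡ size (x ⊕ ⊖ (q ⊗ y)) ℕ.* size y
    size-r = begin
      ∣ norm e ∣                                             ≡⟨ cong size rȳ≡e ⟨
      ∣ norm ((x ⊕ ⊖ (q ⊗ y)) ⊗ conjugate y) ∣               ≡⟨ cong ∣_∣ (norm-⊗ (x ⊕ ⊖ (q ⊗ y)) (conjugate y)) ⟩
      ∣ norm (x ⊕ ⊖ (q ⊗ y)) * norm (conjugate y) ∣          ≡⟨ ℤ.∣i*j∣≡∣i∣*∣j∣ (norm (x ⊕ ⊖ (q ⊗ y))) (norm (conjugate y)) ⟩
      size (x ⊕ ⊖ (q ⊗ y)) ℕ.* ∣ norm (conjugate y) ∣        ≡⟨ cong (λ N → size (x ⊕ ⊖ (q ⊗ y)) ℕ.* ∣ N ∣) (norm-conjugate y) ⟩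
      size (x ⊕ ⊖ (q ⊗ y)) ℕ.* size y                        ∎
      where open ≡-Reasoning

-- Euler's descent

-- A Bézout certificate rather than a condition on divisors, so that each rule of coprimality
-- becomes a single ring identity.
Coprime : ℤ → ℤ → Set
Coprime a b = ∃[ x ] ∃[ y ] x * a + y * b ≡ + 1

coprime-sym : ∀ {a b} → Coprime a b → Coprime b a
coprime-sym {a} {b} (x , y , eq) = y , x , trans (ℤ.+-comm (y * b) (x * a)) eq

-- Multiply the two certificates: in `(x n + y a) (z n + t b)` every term other than `y t a b` is a
-- multiple of `n`.
coprime-* : ∀ {n a b} → Coprime n a → Coprime n b → Coprime n (a * b)
coprime-* {n} {a} {b} (x , y , eq) (z , t , eq′) = x * z * n + x * t * b + y * z * a , y * t ,
  linear₂ (z * n + t * b) (+ 1) eq eq′ (solve (n ∷ a ∷ b ∷ x ∷ y ∷ z ∷ t ∷ []))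

coprime-shift : ∀ {n m} k → Coprime n m → Coprime n (k * n + m)
coprime-shift {n} {m} k (x , y , eq) = x - y * k , y , linear (+ 1) eq (solve (n ∷ m ∷ k ∷ x ∷ y ∷ []))

coprime-factorsˡ : ∀ {a b c d} → Coprime (a * b) (c * d) → Coprime a c
coprime-factorsˡ {a} {b} {c} {d} (x , y , eq) = x * b , y * d , linear (+ 1) eq (solve (a ∷ b ∷ c ∷ d ∷ x ∷ y ∷ []))

coprime-3 : ∀ n → Coprime n (+ 3) ⊎ (∃[ k ] n ≡ + 3 * k)
coprime-3 n = cases (n %ℕ 3) (n /ℕ 3) (n%ℕd<d n 3) (a≡a%ℕn+[a/ℕn]*n n 3)
  where
  cases : ∀ r k → r ℕ.< 3 → n ≡ + r + k * + 3 → Coprime n (+ 3) ⊎ (∃[ k ] n ≡ + 3 * k)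
  cases 0 k _ eq = inj₂ (k , linear (+ 1) eq (solve (n ∷ k ∷ [])))
  cases 1 k _ eq = inj₁ (+ 1 , - k , linear (+ 1) eq (solve (n ∷ k ∷ [])))
  cases 2 k _ eq = inj₁ (- + 1 , k + + 1 , linear (- + 1) eq (solve (n ∷ k ∷ [])))
  cases (suc (suc (suc _))) _ (ℕ.s≤s (ℕ.s≤s (ℕ.s≤s ())))

unit-±1 : ∀ {e f} → e * f ≡ + 1 → f ≡ + 1 ⊎ f ≡ - + 1
unit-±1 {e} {f} ef≡1 = cases f (ℕ.m*n≡1⇒n≡1 ∣ e ∣ ∣ f ∣ (trans (sym (ℤ.∣i*j∣≡∣i∣*∣j∣ e f)) (cong ∣_∣ ef≡1)))
  where
  cases : ∀ f → ∣ f ∣ ≡ 1 → f ≡ + 1 ⊎ f ≡ - + 1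
  cases (+ _)    refl = inj₁ refl
  cases -[1+ _ ] refl = inj₂ refl

-- Abstract, lest applications unfold the Euclidean algorithm.
abstract
  coprime-factor-of-ℤ-cube : ∀ {u v w} → u ≢ + 0 → Coprime u v → u * v ≡ w * w * w → ∃[ d ] u ≡ d * d * d
  coprime-factor-of-ℤ-cube {u} {v} {w} u≢0 (x , y , coprime) uv≡w³ =
    let d , f , e , u≡fd³ , ef≡1 = EuclideanProperties.coprime-factor-of-cube ℤ-euclidean {u} {v} {w} {x} {y} u≢0 coprime uv≡w³
    in  absorb d f u≡fd³ (unit-±1 {e} ef≡1)
    where
    -- Both units of ℤ are cubes, so the unit disappears into the root.
    absorb : ∀ d f → u ≡ f * (d * d * d) → f ≡ + 1 ⊎ f ≡ - + 1 → ∃[ d ] u ≡ d * d * d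
    absorb d f u≡fd³ (inj₁ f≡1)  = d , linear₂ (+ 1) (d * d * d) u≡fd³ f≡1 (solve (u ∷ d ∷ f ∷ []))
    absorb d f u≡fd³ (inj₂ f≡-1) = - d , linear₂ (+ 1) (d * d * d) u≡fd³ f≡-1 (solve (u ∷ d ∷ f ∷ []))

  ℤ-cube-quotient : ∀ {u x y} → x ≢ + 0 → u * (x * x * x) ≡ y * y * y → ∃[ z ] u ≡ z * z * z
  ℤ-cube-quotient {u} {x} {y} = EuclideanProperties.cube-quotient ℤ-euclidean {u} {x} {y}

-- Cubes in ℤ[ω] and the form p² + 3 q²

ω-cube : ℤ[ω] → ℤ[ω]
ω-cube d = d ⊗ d ⊗ d

-- ⟨ n - m , - m ⟩ is ω² ⟨ m , n ⟩.
ω-cube-rotate : ∀ m n → ω-cube ⟨ m , n ⟩ ≡ ω-cube ⟨ n - m , - m ⟩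
ω-cube-rotate m n = cong₂ ⟨_,_⟩
  (solveₚ 2 (λ m n → proj₁ (cubeₚ (m , n)) := proj₁ (cubeₚ (n :- m , :- m))) refl m n)
  (solveₚ 2 (λ m n → proj₂ (cubeₚ (m , n)) := proj₂ (cubeₚ (n :- m , :- m))) refl m n)

-- ⟨ a + b , 2 b ⟩ is a + b √-3.
ω-cube-√-3 : ∀ a b → let p = a * (a * a - + 9 * (b * b)); q = + 3 * b * (a * a - b * b) in
  ω-cube ⟨ a + b , + 2 * b ⟩ ≡ ⟨ p + q , + 2 * q ⟩
ω-cube-√-3 a b = cong₂ ⟨_,_⟩
  (solveₚ 2 (λ a b → proj₁ (cubeₚ (a :+ b , con (+ 2) :* b)) :=
    a :* (a :* a :- con (+ 9) :* (b :* b)) :+ con (+ 3) :* b :* (a :* a :- b :* b)) refl a b)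
  (solveₚ 2 (λ a b → proj₂ (cubeₚ (a :+ b , con (+ 2) :* b)) :=
    con (+ 2) :* (con (+ 3) :* b :* (a :* a :- b :* b))) refl a b)

-- Every element of ℤ[ω] has an associate in ℤ[√-3] by a power of ω, hence with the same cube.
ω-cube-in-ℤ[√-3] : ∀ d → ∃[ a ] ∃[ b ] ω-cube d ≡ ω-cube ⟨ a + b , + 2 * b ⟩
-- The associates by powers of ω have imaginary parts `n`, `- m` and `m - n`, and one of these is
-- even.
ω-cube-in-ℤ[√-3] ⟨ m , n ⟩ = [ when-even m n , (λ n-odd → [ when-re-even , when-both-odd n-odd ]′ (parity m)) ]′ (parity n)
  where
  when-even : ∀ m n → Even n → ∃[ a ] ∃[ b ] ω-cube ⟨ m , n ⟩ ≡ ω-cube ⟨ a + b , + 2 * b ⟩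
  when-even m n (b , n≡2b) = m - b , b , cong₂ (λ x y → ω-cube ⟨ x , y ⟩) (i≡[i-j]+j m b) n≡2b
    where
    i≡[i-j]+j : ∀ i j → i ≡ i - j + j
    i≡[i-j]+j = solve-∀

  when-re-even : Even m → ∃[ a ] ∃[ b ] ω-cube ⟨ m , n ⟩ ≡ ω-cube ⟨ a + b , + 2 * b ⟩
  when-re-even (k , m≡2k) =
    let a , b , eq = when-even (n - m) (- m) (- k , linear (- + 1) m≡2k (solve (m ∷ k ∷ [])))
    in  a , b , trans (ω-cube-rotate m n) eq

  when-both-odd : Odd n → Odd m → ∃[ a ] ∃[ b ] ω-cube ⟨ m , n ⟩ ≡ ω-cube ⟨ a + b , + 2 * b ⟩
  when-both-odd (k , n≡2k+1) (l , m≡2l+1) =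
    let a , b , eq = when-even (- m - (n - m)) (- (n - m)) (l - k , linear₂ (+ 1) (- + 1) m≡2l+1 n≡2k+1 (solve (m ∷ n ∷ k ∷ l ∷ [])))
    in  a , b , trans (ω-cube-rotate m n) (trans (ω-cube-rotate (n - m) (- m)) eq)

unit-norm : ∀ {e f} → e ⊗ f ≡ ⟨ + 1 , + 0 ⟩ → norm f ≡ + 1
unit-norm {e} {f} ef≡1 = trans (norm≡∣norm∣ f) (cong +_ (ℕ.m*n≡1⇒n≡1 ∣ norm e ∣ ∣ norm f ∣
  (trans (sym (ℤ.∣i*j∣≡∣i∣*∣j∣ (norm e) (norm f))) (cong ∣_∣ (trans (sym (norm-⊗ e f)) (cong norm ef≡1))))))

-- With `f₂ = 2 z` the norm is `(f₁ - z)² + 3 z²`, and the value 1 forces `z = 0`: of the six units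
-- only ± 1 lie in ℤ[√-3].
even-im-unit-±1 : ∀ f₁ f₂ → norm ⟨ f₁ , f₂ ⟩ ≡ + 1 → Even f₂ → (f₁ ≡ + 1 ⊎ f₁ ≡ - + 1) × f₂ ≡ + 0
even-im-unit-±1 f₁ f₂ norm≡1 (z , f₂≡2z) = unit-±1 {f₁} f₁²≡1 , f₂≡0
  where
  small : ∀ a b → a ℕ.* a ℕ.+ 3 ℕ.* (b ℕ.* b) ≡ 1 → b ≡ 0
  small a zero    _  = refl
  small a (suc b) eq with ℕ.≤-trans (ℕ.*-monoʳ-≤ 3 (ℕ.s≤s (ℕ.z≤n {b ℕ.+ b ℕ.* suc b}))) (ℕ.≤-trans (ℕ.m≤n+m _ (a ℕ.* a)) (ℕ.≤-reflexive eq))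
  ... | ℕ.s≤s ()
  square : (f₁ - z) * (f₁ - z) + + 3 * (z * z) ≡ + 1
  square = linear₂ (+ 1) (f₁ - f₂ - + 2 * z) norm≡1 f₂≡2z (identity f₁ f₂ z)
    where
    identity : ∀ f₁ f₂ z → (f₁ - z) * (f₁ - z) + + 3 * (z * z) - + 1 ≡
      + 1 * (f₁ * f₁ - f₁ * f₂ + f₂ * f₂ - + 1) + (f₁ - f₂ - + 2 * z) * (f₂ - + 2 * z)
    identity = solve-∀
  z≡0 : z ≡ + 0
  z≡0 = ℤ.∣i∣≡0⇒i≡0 (small ∣ f₁ - z ∣ ∣ z ∣ (ℤ.+-injective (trans (sym (n²+3m² (f₁ - z) z)) square)))
  f₂≡0 : f₂ ≡ + 0
  f₂≡0 = linear₂ (+ 1) (+ 2) f₂≡2z z≡0 (solve (f₂ ∷ z ∷ []))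
  f₁²≡1 : f₁ * f₁ ≡ + 1
  f₁²≡1 = linear₂ (+ 1) (f₁ - f₂) norm≡1 f₂≡0 (identity f₁ f₂)
    where
    identity : ∀ f₁ f₂ → f₁ * f₁ - + 1 ≡ + 1 * (f₁ * f₁ - f₁ * f₂ + f₂ * f₂ - + 1) + (f₁ - f₂) * (f₂ - + 0)
    identity = solve-∀

p²+3q²-odd : ∀ p q → Odd (p + q) → Odd (p * p + + 3 * (q * q))
p²+3q²-odd p q (k , p+q≡2k+1) = + 2 * k * k + + 2 * k - p * q + q * q ,
  linear (p + q + + 2 * k + + 1) p+q≡2k+1 (solve (p ∷ q ∷ k ∷ []))

-- p + q √-3 is the cube of a + b √-3.
record CubeOf√-3 (p q : ℤ) : Set where
  constructor cubeOf√-3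
  field
    a b     : ℤ
    p≡      : p ≡ a * (a * a - + 9 * (b * b))
    q≡      : q ≡ + 3 * b * (a * a - b * b)
    a+b-odd : Odd (a + b)

-- Here `P + Q √-3` is the cube of `a + b √-3`. Modulo 2, `eq-re` makes `P + Q` odd, and then
-- `eq-im` makes `f₂` even, which leaves the units ± 1; the sign is absorbed by negating `a` and
-- `b`.
module UnitTimesCube {p q a b f₁ f₂ : ℤ} (p+q-odd : Odd (p + q)) (norm-f≡1 : norm ⟨ f₁ , f₂ ⟩ ≡ + 1)
  (eq : ⟨ p + q , + 2 * q ⟩ ≡ ⟨ f₁ , f₂ ⟩ ⊗ ω-cube ⟨ a + b , + 2 * b ⟩) where

  P Q : ℤ
  P = a * (a * a - + 9 * (b * b))
  Q = + 3 * b * (a * a - b * b)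

  eq-re : p + q ≡ f₁ * (P + Q) - f₂ * (+ 2 * Q)
  eq-re = cong re (trans eq (cong (⟨ f₁ , f₂ ⟩ ⊗_) (ω-cube-√-3 a b)))

  eq-im : + 2 * q ≡ f₁ * (+ 2 * Q) + f₂ * (P + Q) - f₂ * (+ 2 * Q)
  eq-im = cong im (trans eq (cong (⟨ f₁ , f₂ ⟩ ⊗_) (ω-cube-√-3 a b)))

  f₁[P+Q]-odd : ∀ P Q → p + q ≡ f₁ * (P + Q) - f₂ * (+ 2 * Q) → Odd (p + q) → Odd (f₁ * (P + Q))
  f₁[P+Q]-odd P Q eq-re (k , p+q≡2k+1) = k + f₂ * Q , linear₂ (- + 1) (+ 1) eq-re p+q≡2k+1
    (solve (p ∷ q ∷ f₁ ∷ f₂ ∷ P ∷ Q ∷ k ∷ []))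

  P+Q-odd : Odd (P + Q)
  P+Q-odd = odd-factorʳ f₁ (f₁[P+Q]-odd P Q eq-re p+q-odd)

  f₂-even : ∀ P Q → + 2 * q ≡ f₁ * (+ 2 * Q) + f₂ * (P + Q) - f₂ * (+ 2 * Q) → Odd (P + Q) → Even f₂
  f₂-even P Q eq-im (j , P+Q≡2j+1) = q - f₁ * Q + f₂ * Q - f₂ * j , linear₂ (- f₂) (- + 1) P+Q≡2j+1 eq-im
    (solve (q ∷ f₁ ∷ f₂ ∷ P ∷ Q ∷ j ∷ []))

  -- `(a + b)³` exceeds `P + Q` by `12 a b² + 4 b³`, so it is odd as well, and so is its factor
  -- `a + b`.
  a+b-odd : Odd (a + b)
  a+b-odd = odd-factorʳ ((a + b) * (a + b)) (proj₁ P+Q-odd + + 6 * a * (b * b) + + 2 * b * b * b ,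
    linear (+ 1) (proj₂ P+Q-odd) (identity a b (proj₁ P+Q-odd)))
    where
    identity : ∀ a b j → (a + b) * (a + b) * (a + b) - (+ 2 * (j + + 6 * a * (b * b) + + 2 * b * b * b) + + 1) ≡
      + 1 * (a * (a * a - + 9 * (b * b)) + + 3 * b * (a * a - b * b) - (+ 2 * j + + 1))
    identity = solve-∀

  f≡±1 : (f₁ ≡ + 1 ⊎ f₁ ≡ - + 1) × f₂ ≡ + 0
  f≡±1 = even-im-unit-±1 f₁ f₂ norm-f≡1 (f₂-even P Q eq-im P+Q-odd)

  q≡f₁Q : ∀ {P} Q → + 2 * q ≡ f₁ * (+ 2 * Q) + f₂ * (P + Q) - f₂ * (+ 2 * Q) → q ≡ f₁ * Q
  q≡f₁Q {P} Q eq-im = mult-cancelˡ (+ 2) (λ ()) (linear₂ (+ 1) (P - Q) eq-im (proj₂ f≡±1) (solve (q ∷ f₁ ∷ f₂ ∷ P ∷ Q ∷ [])))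

  p+q≡f₁[P+Q] : ∀ P Q → p + q ≡ f₁ * (P + Q) - f₂ * (+ 2 * Q) → p + q ≡ f₁ * (P + Q)
  p+q≡f₁[P+Q] P Q eq-re = linear₂ (+ 1) (- (+ 2 * Q)) eq-re (proj₂ f≡±1) (solve (p ∷ q ∷ f₁ ∷ f₂ ∷ P ∷ Q ∷ []))

  p≡f₁P : ∀ P Q → p + q ≡ f₁ * (P + Q) → q ≡ f₁ * Q → p ≡ f₁ * P
  p≡f₁P P Q eq eq′ = linear₂ (+ 1) (- + 1) eq eq′ (solve (p ∷ q ∷ f₁ ∷ P ∷ Q ∷ []))

  absorb : p ≡ f₁ * P → q ≡ f₁ * Q → f₁ ≡ + 1 ⊎ f₁ ≡ - + 1 → CubeOf√-3 p q
  absorb p≡f₁P q≡f₁Q (inj₁ f₁≡1) = cubeOf√-3 a b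
    (trans p≡f₁P (trans (cong (_* P) f₁≡1) (ℤ.*-identityˡ P)))
    (trans q≡f₁Q (trans (cong (_* Q) f₁≡1) (ℤ.*-identityˡ Q))) a+b-odd
  absorb p≡f₁P q≡f₁Q (inj₂ f₁≡-1) = cubeOf√-3 (- a) (- b)
    (trans p≡f₁P (trans (cong (_* P) f₁≡-1) (p-neg a b)))
    (trans q≡f₁Q (trans (cong (_* Q) f₁≡-1) (q-neg a b)))
    (odd-neg a b a+b-odd)
    where
    p-neg : ∀ a b → - + 1 * (a * (a * a - + 9 * (b * b))) ≡ - a * (- a * - a - + 9 * (- b * - b))
    p-neg = solve-∀
    q-neg : ∀ a b → - + 1 * (+ 3 * b * (a * a - b * b)) ≡ + 3 * - b * (- a * - a - - b * - b)
    q-neg = solve-∀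
    odd-neg : ∀ a b → Odd (a + b) → Odd (- a + - b)
    odd-neg a b (k , a+b≡2k+1) = - k - + 1 , linear (- + 1) a+b≡2k+1 (solve (a ∷ b ∷ k ∷ []))

  isCube : CubeOf√-3 p q
  isCube = absorb (p≡f₁P P Q (p+q≡f₁[P+Q] P Q eq-re) (q≡f₁Q {P} Q eq-im)) (q≡f₁Q {P} Q eq-im) (proj₁ f≡±1)

-- p + q √-3 is coprime to its conjugate, so it is a unit times a cube in ℤ[ω]; by parity the unit is ± 1.
module NormIsCube {p q z a b : ℤ} (ap+3bq≡1 : a * p + b * (+ 3 * q) ≡ + 1) (p+q-odd : Odd (p + q))
  (norm≡z³ : p * p + + 3 * (q * q) ≡ z * z * z) where

  k : ℤ
  k = proj₁ (p²+3q²-odd p q p+q-odd)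

  u v x y : ℤ[ω]
  u = ⟨ p + q , + 2 * q ⟩
  v = ⟨ p - q , - (+ 2 * q) ⟩
  -- As `√-3 = 1 + 2 ω`, `u` and `v` are `p + q √-3` and its conjugate. With `γ = a + b √-3`, `x` is
  -- `- k` times the conjugate of `γ` and `y` is `u - k γ`, so `x u + y v = u v - 2 k (a p + 3 b q)
  -- = (2 k + 1) - 2 k`.
  x = ⟨ - k * (a - b) , + 2 * k * b ⟩
  y = ⟨ p + q - k * (a + b) , + 2 * q - + 2 * k * b ⟩

  u≢0 : u ≢ ⟨ + 0 , + 0 ⟩
  u≢0 u≡0 = odd-≢0 p+q-odd (cong re u≡0)

  coprime : x ⊗ u ⊕ y ⊗ v ≡ ⟨ + 1 , + 0 ⟩
  coprime = cong₂ ⟨_,_⟩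
    (re-part p q a b k ap+3bq≡1 (proj₂ (p²+3q²-odd p q p+q-odd))) (im-part p q a b k)
    where
    re-part : ∀ p q a b k → a * p + b * (+ 3 * q) ≡ + 1 → p * p + + 3 * (q * q) ≡ + 2 * k + + 1 →
      - k * (a - b) * (p + q) - + 2 * k * b * (+ 2 * q) +
      ((p + q - k * (a + b)) * (p - q) - (+ 2 * q - + 2 * k * b) * - (+ 2 * q)) ≡ + 1
    re-part p q a b k eq eq′ = linear₂ (- (+ 2 * k)) (+ 1) eq eq′ (solve (p ∷ q ∷ a ∷ b ∷ k ∷ []))
    im-part : ∀ p q a b k →
      - k * (a - b) * (+ 2 * q) + + 2 * k * b * (p + q) - + 2 * k * b * (+ 2 * q) +
      ((p + q - k * (a + b)) * - (+ 2 * q) + (+ 2 * q - + 2 * k * b) * (p - q) - (+ 2 * q - + 2 * k * b) * - (+ 2 * q)) ≡ + 0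
    im-part = solve-∀

  uv≡z³ : u ⊗ v ≡ ω-cube ⟨ z , + 0 ⟩
  uv≡z³ = cong₂ ⟨_,_⟩ (re-part p q z norm≡z³) (im-part p q z)
    where
    re-part : ∀ p q z → p * p + + 3 * (q * q) ≡ z * z * z →
      (p + q) * (p - q) - + 2 * q * - (+ 2 * q) ≡ (z * z - + 0 * + 0) * z - (z * + 0 + + 0 * z - + 0 * + 0) * + 0
    re-part p q z eq = linear (+ 1) eq (solve (p ∷ q ∷ z ∷ []))
    im-part : ∀ p q z → (p + q) * - (+ 2 * q) + + 2 * q * (p - q) - + 2 * q * - (+ 2 * q) ≡
      (z * z - + 0 * + 0) * + 0 + (z * + 0 + + 0 * z - + 0 * + 0) * z - (z * + 0 + + 0 * z - + 0 * + 0) * + 0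
    im-part = solve-∀

  from-root : ∃[ d ] ∃[ f ] ∃[ e ] (u ≡ f ⊗ ω-cube d × e ⊗ f ≡ ⟨ + 1 , + 0 ⟩) → CubeOf√-3 p q
  from-root (d , ⟨ f₁ , f₂ ⟩ , e , u≡fd³ , ef≡1) = in-ℤ[√-3] (ω-cube-in-ℤ[√-3] d)
    where
    in-ℤ[√-3] : ∃[ a ] ∃[ b ] ω-cube d ≡ ω-cube ⟨ a + b , + 2 * b ⟩ → CubeOf√-3 p q
    in-ℤ[√-3] (a , b , d³≡) = UnitTimesCube.isCube {p} {q} {a} {b} {f₁} {f₂} p+q-odd (unit-norm {e} {⟨ f₁ , f₂ ⟩} ef≡1)
      (trans u≡fd³ (cong (⟨ f₁ , f₂ ⟩ ⊗_) d³≡))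

  isCube : CubeOf√-3 p q
  isCube = from-root (EuclideanProperties.coprime-factor-of-cube ℤ[ω]-euclidean {u} {v} {⟨ z , + 0 ⟩} {x} {y} u≢0 coprime uv≡z³)

p²+3q²-cube : ∀ {p q z} → Coprime p (+ 3 * q) → Odd (p + q) → p * p + + 3 * (q * q) ≡ z * z * z → CubeOf√-3 p q
p²+3q²-cube {p} {q} {z} (a , b , ap+3bq≡1) p+q-odd norm≡z³ = NormIsCube.isCube {p} {q} {z} {a} {b} ap+3bq≡1 p+q-odd norm≡z³

-- Infinite descent on the size of q

factor-≤ : ∀ {n a b} → n ≡ a * b → n ≢ + 0 → ∣ a ∣ ℕ.≤ ∣ n ∣
factor-≤ {n} {a} {b} n≡ab n≢0 = subst (∣ a ∣ ℕ.≤_) (sym (trans (cong ∣_∣ n≡ab) (ℤ.∣i*j∣≡∣i∣*∣j∣ a b)))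
  (ℕ.m≤m*n ∣ a ∣ ∣ b ∣ {{ℕ.≢-nonZero (λ eq → n≢0 (trans n≡ab (trans (cong (a *_) (ℤ.∣i∣≡0⇒i≡0 eq)) (ℤ.*-zeroʳ a))))}})

≢0-factorˡ : ∀ {n a b} → n ≡ a * b → n ≢ + 0 → a ≢ + 0
≢0-factorˡ {b = b} n≡ab n≢0 refl = n≢0 (trans n≡ab (ℤ.*-zeroˡ b))

-- The form p (p² + 3 q²) of (x³ + y³) / 2 with x = p + q and y = p - q.
record Solution (q : ℤ) : Set where
  constructor solution
  field
    p c        : ℤ
    pq-coprime : Coprime p q
    p+q-odd    : Odd (p + q)
    p≢0        : p ≢ + 0
    q≢0        : q ≢ + 0
    isCube     : p * (p * p + + 3 * (q * q)) ≡ c * c * c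

-- `A`, `A - B` and `A + B` are pairwise coprime, hence cubes `c³`, `d³` and `e³` with `d` and `e`
-- odd. For the half sum `p` and half difference `q` of `e` and `d` one gets
-- `c³ = A = p (p² + 3 q²)` and `B = q (q² + 3 p²)`, so `q` is a proper divisor of `B` and smaller.
module DescentStep {A B w x y k : ℤ} (A≢0 : A ≢ + 0) (B≢0 : B ≢ + 0) (xA+yB≡1 : x * A + y * B ≡ + 1)
  (A+B≡2k+1 : A + B ≡ + 2 * k + + 1) (isCube : A * ((A - B) * (A + B)) ≡ w * w * w) where

  A-B-odd : Odd (A - B)
  A-B-odd = k - B , linear (+ 1) A+B≡2k+1 (solve (A ∷ B ∷ k ∷ []))

  A-B≢0 : A - B ≢ + 0
  A-B≢0 = odd-≢0 A-B-odd

  A+B≢0 : A + B ≢ + 0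
  A+B≢0 = odd-≢0 (k , A+B≡2k+1)

  -- Square `x A + y B = 1` and replace `B²` by `A² - (A - B) (A + B)`.
  coprime : Coprime A ((A - B) * (A + B))
  coprime = x * x * A + + 2 * x * y * B + y * y * A , - (y * y) ,
    linear (x * A + y * B + + 1) xA+yB≡1 (solve (A ∷ B ∷ x ∷ y ∷ []))

  -- `(x - y) (A - B) + (x + y) (A + B)` equals 2, and subtracting `k` times it from the odd number
  -- `A + B = 2 k + 1` leaves 1.
  coprime′ : Coprime (A - B) (A + B)
  coprime′ = - k * (x - y) , + 1 - k * (x + y) ,
    linear₂ (+ 1) (- (+ 2 * k)) A+B≡2k+1 xA+yB≡1 (solve (A ∷ B ∷ x ∷ y ∷ k ∷ []))

  module HalfSums {p q c : ℤ} (p+q-odd : Odd (p + q)) (A≡c³ : A ≡ c * c * c)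
    (A-B≡[p-q]³ : A - B ≡ (p - q) * (p - q) * (p - q)) (A+B≡[p+q]³ : A + B ≡ (p + q) * (p + q) * (p + q)) where

    A≡ : A ≡ p * (p * p + + 3 * (q * q))
    A≡ = mult-cancelˡ (+ 2) (λ ()) (linear₂ (+ 1) (+ 1) A-B≡[p-q]³ A+B≡[p+q]³ (solve (A ∷ B ∷ p ∷ q ∷ [])))

    B≡ : B ≡ q * (q * q + + 3 * (p * p))
    B≡ = mult-cancelˡ (+ 2) (λ ()) (linear₂ (- + 1) (+ 1) A-B≡[p-q]³ A+B≡[p+q]³ (solve (A ∷ B ∷ p ∷ q ∷ [])))

    p≢0 : p ≢ + 0
    p≢0 = ≢0-factorˡ {A} {p} {p * p + + 3 * (q * q)} A≡ A≢0

    q≢0 : q ≢ + 0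
    q≢0 = ≢0-factorˡ {B} {q} {q * q + + 3 * (p * p)} B≡ B≢0

    pq-coprime : Coprime p q
    pq-coprime = halve (proj₁ coprime′) (proj₁ (proj₂ coprime′))
      (trans (sym (cong₂ (λ s t → proj₁ coprime′ * s + proj₁ (proj₂ coprime′) * t) A-B≡[p-q]³ A+B≡[p+q]³)) (proj₂ (proj₂ coprime′)))
      where
      halve : ∀ x y → x * ((p - q) * (p - q) * (p - q)) + y * ((p + q) * (p + q) * (p + q)) ≡ + 1 → Coprime p q
      halve x y eq = x * ((p - q) * (p - q)) + y * ((p + q) * (p + q)) , y * ((p + q) * (p + q)) - x * ((p - q) * (p - q)) ,
        linear (+ 1) eq (solve (p ∷ q ∷ x ∷ y ∷ []))

    1<q²+3p² : 1 ℕ.< ∣ q * q + + 3 * (p * p) ∣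
    1<q²+3p² = subst (1 ℕ.<_) (cong ∣_∣ (sym (n²+3m² q p)))
      (ℕ.≤-trans (ℕ.≤-trans (ℕ.s≤s (ℕ.s≤s ℕ.z≤n)) (ℕ.*-monoʳ-≤ 3 (ℕ.*-mono-≤ 1≤p 1≤p))) (ℕ.m≤n+m _ (∣ q ∣ ℕ.* ∣ q ∣)))
      where
      1≤p : 1 ℕ.≤ ∣ p ∣
      1≤p = ℕ.n≢0⇒n>0 (λ eq → p≢0 (ℤ.∣i∣≡0⇒i≡0 eq))

    q<B : ∣ q ∣ ℕ.< ∣ B ∣
    q<B = subst (∣ q ∣ ℕ.<_) (sym (trans (cong ∣_∣ B≡) (ℤ.∣i*j∣≡∣i∣*∣j∣ q (q * q + + 3 * (p * p)))))
      (ℕ.m<m*n ∣ q ∣ ∣ q * q + + 3 * (p * p) ∣ {{ℕ.≢-nonZero (λ eq → q≢0 (ℤ.∣i∣≡0⇒i≡0 eq))}} 1<q²+3p²)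

    result : ∃[ q ] Solution q × ∣ q ∣ ℕ.< ∣ B ∣
    result = q , solution p c pq-coprime p+q-odd p≢0 q≢0 (trans (sym A≡) A≡c³) , q<B

  parities : ∀ {c d e} → A ≡ c * c * c → A - B ≡ d * d * d → A + B ≡ e * e * e → Odd d → Odd e →
    ∃[ q ] Solution q × ∣ q ∣ ℕ.< ∣ B ∣
  parities {c} {d} {e} A≡c³ A-B≡d³ A+B≡e³ (i , d≡2i+1) (j , e≡2j+1) =
    -- `(d + e) / 2` and `(e - d) / 2` for `d = 2 i + 1` and `e = 2 j + 1`.
    HalfSums.result {i + j + + 1} {j - i} {c} (j , solve (i ∷ j ∷ [])) A≡c³
      (trans A-B≡d³ (cong (λ d → d * d * d) d≡p-q)) (trans A+B≡e³ (cong (λ e → e * e * e) e≡p+q))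
    where
    d≡p-q : d ≡ i + j + + 1 - (j - i)
    d≡p-q = linear (+ 1) d≡2i+1 (solve (d ∷ i ∷ j ∷ []))
    e≡p+q : e ≡ i + j + + 1 + (j - i)
    e≡p+q = linear (+ 1) e≡2j+1 (solve (e ∷ i ∷ j ∷ []))

  roots : ∃[ c ] A ≡ c * c * c → ∃[ d ] A - B ≡ d * d * d → ∃[ e ] A + B ≡ e * e * e →
    ∃[ q ] Solution q × ∣ q ∣ ℕ.< ∣ B ∣
  roots (c , A≡c³) (d , A-B≡d³) (e , A+B≡e³) = parities {c} {d} {e} A≡c³ A-B≡d³ A+B≡e³
    (odd-factorʳ (d * d) (subst Odd A-B≡d³ A-B-odd)) (odd-factorʳ (e * e) (subst Odd A+B≡e³ (k , A+B≡2k+1)))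

  split : ∃[ W ] (A - B) * (A + B) ≡ W * W * W → ∃[ q ] Solution q × ∣ q ∣ ℕ.< ∣ B ∣
  split (W , A²-B²≡W³) = roots
    (coprime-factor-of-ℤ-cube {A} {(A - B) * (A + B)} {w} A≢0 coprime isCube)
    (coprime-factor-of-ℤ-cube {A - B} {A + B} {W} A-B≢0 coprime′ A²-B²≡W³)
    (coprime-factor-of-ℤ-cube {A + B} {A - B} {W} A+B≢0 (coprime-sym {A - B} coprime′)
      (trans (ℤ.*-comm (A + B) (A - B)) A²-B²≡W³))

  smaller : ∃[ q ] Solution q × ∣ q ∣ ℕ.< ∣ B ∣
  smaller = split (coprime-factor-of-ℤ-cube {(A - B) * (A + B)} {A} {w} (*-≢0 A-B≢0 A+B≢0) (coprime-sym {A} coprime)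
    (trans (ℤ.*-comm ((A - B) * (A + B)) A) isCube))

descent-step : ∀ {A B w} → A ≢ + 0 → B ≢ + 0 → Coprime A B → Odd (A + B) → A * ((A - B) * (A + B)) ≡ w * w * w →
  ∃[ q ] Solution q × ∣ q ∣ ℕ.< ∣ B ∣
descent-step {A} {B} {w} A≢0 B≢0 (x , y , xA+yB≡1) (k , A+B≡2k+1) isCube =
  DescentStep.smaller {A} {B} {w} {x} {y} {k} A≢0 B≢0 xA+yB≡1 A+B≡2k+1 isCube

-- As 3 does not divide `p`, the factors `p` and `T` are coprime and both cubes. The cube root
-- `a + b √-3` gives `p = a (a - 3 b) (a + 3 b)`, which is the situation of `descent-step` with
-- `A = a` and `B = 3 b`; the new value is below `3 b`, a divisor of `q`.
module ThreeCoprime {p q c : ℤ} (p3-coprime : Coprime p (+ 3)) (pq-coprime : Coprime p q) (p+q-odd : Odd (p + q))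
  (p≢0 : p ≢ + 0) (q≢0 : q ≢ + 0) (isCube : p * (p * p + + 3 * (q * q)) ≡ c * c * c) where

  T : ℤ
  T = p * p + + 3 * (q * q)

  T-coprime : Coprime p T
  T-coprime = coprime-shift {p} {+ 3 * (q * q)} p (coprime-* {p} {+ 3} p3-coprime (coprime-* {p} {q} pq-coprime pq-coprime))

  smaller : ∃[ w ] p ≡ w * w * w → CubeOf√-3 p q → ∃[ q′ ] Solution q′ × ∣ q′ ∣ ℕ.< ∣ q ∣
  smaller (w , p≡w³) (cubeOf√-3 a b p≡ q≡ (j , a+b≡2j+1)) =
    let q′ , s , q′<B = descent-step {a} {+ 3 * b} {w} (≢0-factorˡ {p} {a} p≡ p≢0) (≢0-factorˡ {q} {+ 3 * b} q≡ q≢0)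
          (coprime-factorsˡ {a} {a * a - + 9 * (b * b)} {+ 3 * b} (subst₂ Coprime p≡ q≡ pq-coprime))
          (j + b , linear (+ 1) a+b≡2j+1 (solve (a ∷ b ∷ j ∷ [])))
          (trans (factorise a b) (trans (sym p≡) p≡w³))
    in  q′ , s , ℕ.<-≤-trans q′<B (factor-≤ {q} {+ 3 * b} q≡ q≢0)
    where
    factorise : ∀ a b → a * ((a - + 3 * b) * (a + + 3 * b)) ≡ a * (a * a - + 9 * (b * b))
    factorise = solve-∀

  T-cube : ∃[ t ] T ≡ t * t * t
  T-cube = coprime-factor-of-ℤ-cube {T} {p} {c} (odd-≢0 (p²+3q²-odd p q p+q-odd)) (coprime-sym {p} T-coprime)
    (trans (ℤ.*-comm T p) isCube)

  result : ∃[ q′ ] Solution q′ × ∣ q′ ∣ ℕ.< ∣ q ∣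
  result = smaller (coprime-factor-of-ℤ-cube {p} {T} {c} p≢0 T-coprime isCube)
    (p²+3q²-cube {p} {q} {proj₁ T-cube} (coprime-* {p} {+ 3} p3-coprime pq-coprime) p+q-odd (proj₂ T-cube))

-- For `p = 3 s` the product is `9 s (q² + 3 s²)`, with coprime factors, and `q` and `s` exchange
-- roles: `q + s √-3` is the cube of `a + b √-3`. Now `9 s = 27 b (a² - b²)` is a cube, so
-- `b (a² - b²)` is one, and `descent-step` applies with `A = b` and `B = a`, a divisor of `q`.
module ThreeDivides {q s c : ℤ} (3sq-coprime : Coprime (+ 3 * s) q) (3s+q-odd : Odd (+ 3 * s + q))
  (s≢0 : s ≢ + 0) (q≢0 : q ≢ + 0) (isCube : + 3 * s * (+ 3 * s * (+ 3 * s) + + 3 * (q * q)) ≡ c * c * c) where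

  T : ℤ
  T = q * q + + 3 * (s * s)

  T≡ : ∀ q s → s * (+ 3 * s) + q * q ≡ q * q + + 3 * (s * s)
  T≡ = solve-∀

  q+s-odd : Odd (q + s)
  q+s-odd = proj₁ 3s+q-odd - s , shift q s (proj₁ 3s+q-odd) (proj₂ 3s+q-odd)
    where
    shift : ∀ q s k → + 3 * s + q ≡ + 2 * k + + 1 → q + s ≡ + 2 * (k - s) + + 1
    shift q s k eq = linear (+ 1) eq (solve (q ∷ s ∷ k ∷ []))

  9sT≡c³ : + 3 * (+ 3 * s) * T ≡ c * c * c
  9sT≡c³ = trans (expand q s) isCube
    where
    expand : ∀ q s → + 3 * (+ 3 * s) * (q * q + + 3 * (s * s)) ≡ + 3 * s * (+ 3 * s * (+ 3 * s) + + 3 * (q * q))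
    expand = solve-∀

  3sT-coprime : Coprime (+ 3 * s) T
  3sT-coprime = subst (Coprime (+ 3 * s)) (T≡ q s)
    (coprime-shift {+ 3 * s} {q * q} s (coprime-* {+ 3 * s} {q} 3sq-coprime 3sq-coprime))

  T-coprime : Coprime T (+ 3 * (+ 3 * s))
  T-coprime = coprime-* {T} {+ 3}
    (coprime-sym {+ 3} (coprime-factorsˡ {+ 3} {s} {T} {+ 1} (subst (Coprime (+ 3 * s)) (sym (ℤ.*-identityʳ T)) 3sT-coprime)))
    (coprime-sym {+ 3 * s} 3sT-coprime)

  smaller : ∃[ r ] + 3 * (+ 3 * s) ≡ r * r * r → CubeOf√-3 q s → ∃[ q′ ] Solution q′ × ∣ q′ ∣ ℕ.< ∣ q ∣
  smaller (r , 9s≡r³) (cubeOf√-3 a b q≡ s≡ (j , a+b≡2j+1)) =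
    quotient (ℤ-cube-quotient {b * (a * a - b * b)} {+ 3} {r} (λ ()) (linear₂ (- + 9) (+ 1) s≡ 9s≡r³ (solve (a ∷ b ∷ s ∷ r ∷ []))))
    where
    3s≡ : + 3 * s ≡ b * (+ 9 * (a * a - b * b))
    3s≡ = linear (+ 3) s≡ (solve (a ∷ b ∷ s ∷ []))
    b≢0 : b ≢ + 0
    b≢0 b≡0 = s≢0 (linear₂ (+ 1) (+ 3 * (a * a - b * b)) s≡ b≡0 (solve (a ∷ b ∷ s ∷ [])))
    quotient : ∃[ w ] b * (a * a - b * b) ≡ w * w * w → ∃[ q′ ] Solution q′ × ∣ q′ ∣ ℕ.< ∣ q ∣
    quotient (w , eq) =
      let q′ , s′ , q′<a = descent-step {b} {a} { - w} b≢0 (≢0-factorˡ {q} {a} q≡ q≢0)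
            (coprime-factorsˡ {b} {+ 9 * (a * a - b * b)} {a} {a * a - + 9 * (b * b)} (subst₂ Coprime 3s≡ q≡ 3sq-coprime))
            (j , trans (ℤ.+-comm b a) a+b≡2j+1)
            (linear (- + 1) eq (solve (a ∷ b ∷ w ∷ [])))
      in  q′ , s′ , ℕ.<-≤-trans q′<a (factor-≤ {q} {a} q≡ q≢0)

  T-cube : ∃[ t ] T ≡ t * t * t
  T-cube = coprime-factor-of-ℤ-cube {T} {+ 3 * (+ 3 * s)} {c} (odd-≢0 (p²+3q²-odd q s q+s-odd)) T-coprime
    (trans (ℤ.*-comm T (+ 3 * (+ 3 * s))) 9sT≡c³)

  result : ∃[ q′ ] Solution q′ × ∣ q′ ∣ ℕ.< ∣ q ∣
  result = smaller
    (coprime-factor-of-ℤ-cube {+ 3 * (+ 3 * s)} {T} {c} (*-≢0 {+ 3} (λ ()) (*-≢0 {+ 3} (λ ()) s≢0)) (coprime-sym {T} T-coprime) 9sT≡c³)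
    (p²+3q²-cube {q} {s} {proj₁ T-cube} (coprime-sym {+ 3 * s} 3sq-coprime) q+s-odd (proj₂ T-cube))

smaller-solution : ∀ {q} → Solution q → ∃[ q′ ] Solution q′ × ∣ q′ ∣ ℕ.< ∣ q ∣
smaller-solution {q} (solution p c pq-coprime p+q-odd p≢0 q≢0 isCube) = [ three-coprime , three-divides ]′ (coprime-3 p)
  where
  three-coprime : Coprime p (+ 3) → ∃[ q′ ] Solution q′ × ∣ q′ ∣ ℕ.< ∣ q ∣
  three-coprime p3-coprime = ThreeCoprime.result {p} {q} {c} p3-coprime pq-coprime p+q-odd p≢0 q≢0 isCube
  three-divides : ∃[ s ] p ≡ + 3 * s → ∃[ q′ ] Solution q′ × ∣ q′ ∣ ℕ.< ∣ q ∣
  three-divides (s , refl) = ThreeDivides.result {q} {s} {c} pq-coprime p+q-odd (λ s≡0 → p≢0 (cong (+ 3 *_) s≡0)) q≢0 isCube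

no-solution : ∀ {q} → ¬ Solution q
no-solution {q} = descend (<-wellFounded ∣ q ∣)
  where
  descend : ∀ {q} → Acc ℕ._<_ ∣ q ∣ → ¬ Solution q
  descend (acc rec) s = let _ , s′ , q′<q = smaller-solution s in descend (rec q′<q) s′

-- The sequence as monomials

-- Sign and the exponents of α, α - 1 and 2 α - 1 as data: at a fixed index, identities between
-- monomials then hold by computation. `zero` is there for the indices divisible by 8.
data Mono : Set where
  zero : Mono
  mono : Sign → ℕ → ℕ → ℕ → Mono

infixl 7 _·_
infixr 8 _^ᵐ_

_·_ : Mono → Mono → Mono
zero         · _              = zero
mono _ _ _ _ · zero           = zero
mono s a b c · mono s′ a′ b′ c′ = mono (s Sign.* s′) (a ℕ.+ a′) (b ℕ.+ b′) (c ℕ.+ c′)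

_^ᵐ_ : Mono → ℕ → Mono
m ^ᵐ zero  = mono Sign.+ 0 0 0
m ^ᵐ suc n = m · m ^ᵐ n

period : Mono
period = mono Sign.- 15 7 6

-- h n as a monomial in α, α - 1 and 2 α - 1; the quasi-period 8 is the order of the point (0 , 0).
h-mono : ℕ → Mono
h-mono 0 = zero
h-mono 1 = mono Sign.+ 0 0 0
h-mono 2 = mono Sign.- 3 1 1
h-mono 3 = mono Sign.- 8 3 3
h-mono 4 = mono Sign.+ 14 6 6
h-mono 5 = mono Sign.+ 23 10 9
h-mono 6 = mono Sign.- 33 15 13
h-mono 7 = mono Sign.- 45 21 18
h-mono (suc (suc (suc (suc (suc (suc (suc (suc n)))))))) = mono Sign.- 0 0 0 · period ^ᵐ (n ℕ.+ 4) · h-mono n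

module Evaluation (α : ℤ) where

  sgn : Sign → ℤ
  sgn Sign.+ = + 1
  sgn Sign.- = - + 1

  abstract
    ev : Mono → ℤ
    ev zero           = + 0
    ev (mono s a b c) = sgn s * (α ^ a * (α - + 1) ^ b * (+ 2 * α - + 1) ^ c)

    ev-· : ∀ m n → ev (m · n) ≡ ev m * ev n
    ev-· zero           n    = sym (ℤ.*-zeroˡ (ev n))
    ev-· (mono s a b c) zero = sym (ℤ.*-zeroʳ (ev (mono s a b c)))
    ev-· (mono s a b c) (mono s′ a′ b′ c′) = trans
      (cong₂ _*_ (sgn-* s s′) (cong₂ _*_ (cong₂ _*_ (ℤ.^-distribˡ-+-* α a a′)
        (ℤ.^-distribˡ-+-* (α - + 1) b b′)) (ℤ.^-distribˡ-+-* (+ 2 * α - + 1) c c′)))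
      (interchange (sgn s) (sgn s′) (α ^ a) (α ^ a′) ((α - + 1) ^ b) ((α - + 1) ^ b′)
        ((+ 2 * α - + 1) ^ c) ((+ 2 * α - + 1) ^ c′))
      where
      sgn-* : ∀ s t → sgn (s Sign.* t) ≡ sgn s * sgn t
      sgn-* Sign.+ Sign.+ = refl
      sgn-* Sign.+ Sign.- = refl
      sgn-* Sign.- Sign.+ = refl
      sgn-* Sign.- Sign.- = refl
      interchange : ∀ s s′ a a′ b b′ c c′ → s * s′ * (a * a′ * (b * b′) * (c * c′)) ≡ s * (a * b * c) * (s′ * (a′ * b′ * c′))
      interchange = solve-∀

    ev-1 : ev (mono Sign.+ 0 0 0) ≡ + 1
    ev-1 = refl

    ev-neg : ev (mono Sign.- 0 0 0) ≡ - + 1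
    ev-neg = refl

    ev-≢0 : α ≢ + 0 → α - + 1 ≢ + 0 → + 2 * α - + 1 ≢ + 0 → ∀ {s a b c} → ev (mono s a b c) ≢ + 0
    ev-≢0 α≢0 α-1≢0 2α-1≢0 {s} {a} {b} {c} = *-≢0 {sgn s} (sgn-≢0 s)
      (*-≢0 {α ^ a * (α - + 1) ^ b} (*-≢0 {α ^ a} (λ eq → α≢0 (ℤ.i^n≡0⇒i≡0 α a eq)) (λ eq → α-1≢0 (ℤ.i^n≡0⇒i≡0 _ b eq)))
        (λ eq → 2α-1≢0 (ℤ.i^n≡0⇒i≡0 _ c eq)))
      where
      sgn-≢0 : ∀ s → sgn s ≢ + 0
      sgn-≢0 Sign.+ ()
      sgn-≢0 Sign.- ()

    ev-h₀ : ev (h-mono 0) ≡ + 0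
    ev-h₀ = refl

    ev-h₂ : ev (h-mono 2) ≡ - (α ^ 3 * (α - + 1) * (+ 2 * α - + 1))
    ev-h₂ = identity (α ^ 3) (α - + 1) (+ 2 * α - + 1)
      where
      identity : ∀ x y z → - + 1 * (x * (y * + 1) * (z * + 1)) ≡ - (x * y * z)
      identity = solve-∀

    ev-h₃ : ev (h-mono 3) ≡ - (α ^ 8 * (α - + 1) ^ 3 * (+ 2 * α - + 1) ^ 3)
    ev-h₃ = ℤ.-1*i≡-i _

    ev-h₄ : ev (h-mono 4) ≡ α ^ 14 * (α - + 1) ^ 6 * (+ 2 * α - + 1) ^ 6
    ev-h₄ = ℤ.*-identityˡ _

    ev-[α-1][2α-1] : ev (mono Sign.+ 0 1 1) ≡ (α - + 1) * (+ 2 * α - + 1)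
    ev-[α-1][2α-1] = identity (α - + 1) (+ 2 * α - + 1)
      where
      identity : ∀ y z → + 1 * (+ 1 * (y * + 1) * (z * + 1)) ≡ y * z
      identity = solve-∀

    ev-α²[α-1] : ev (mono Sign.+ 2 1 0) ≡ α * α * (α - + 1)
    ev-α²[α-1] = identity α (α - + 1)
      where
      identity : ∀ x y → + 1 * (x * (x * + 1) * (y * + 1) * + 1) ≡ x * x * y
      identity = solve-∀

    ev-α²[α-1]² : ev (mono Sign.+ 2 2 0) ≡ α * α * ((α - + 1) * (α - + 1))
    ev-α²[α-1]² = identity α (α - + 1)
      where
      identity : ∀ x y → + 1 * (x * (x * + 1) * (y * (y * + 1)) * + 1) ≡ x * x * (y * y)
      identity = solve-∀

    -- The recurrences for 2 ≤ m ≤ 10, divided by the largest common monomial.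
    relation₀ : ev (mono Sign.+ 0 1 0) ≡ ev (mono Sign.- 0 0 0) - ev (mono Sign.- 1 0 0)
    relation₀ = identity α
      where
      identity : ∀ α → + 1 * (+ 1 * ((α - + 1) * + 1) * + 1) ≡
        - + 1 * (+ 1 * + 1 * + 1) - - + 1 * ((α * + 1) * + 1 * + 1)
      identity = solve-∀

    relation₁ : ev (mono Sign.- 0 2 0) ≡ ev (mono Sign.- 2 0 0) - ev (mono Sign.- 0 0 1)
    relation₁ = identity α
      where
      identity : ∀ α → - + 1 * (+ 1 * ((α - + 1) * ((α - + 1) * + 1)) * + 1) ≡
        - + 1 * ((α * (α * + 1)) * + 1 * + 1) - - + 1 * (+ 1 * + 1 * ((+ 2 * α - + 1) * + 1))
      identity = solve-∀

    relation₂ : ev (mono Sign.+ 0 2 0) ≡ ev (mono Sign.- 0 0 1) - ev (mono Sign.- 2 0 0)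
    relation₂ = identity α
      where
      identity : ∀ α → + 1 * (+ 1 * ((α - + 1) * ((α - + 1) * + 1)) * + 1) ≡
        - + 1 * (+ 1 * + 1 * ((+ 2 * α - + 1) * + 1)) - - + 1 * ((α * (α * + 1)) * + 1 * + 1)
      identity = solve-∀

    relation₃ : ev (mono Sign.- 0 1 0) ≡ ev (mono Sign.- 1 0 0) - ev (mono Sign.- 0 0 0)
    relation₃ = identity α
      where
      identity : ∀ α → - + 1 * (+ 1 * ((α - + 1) * + 1) * + 1) ≡
        - + 1 * ((α * + 1) * + 1 * + 1) - - + 1 * (+ 1 * + 1 * + 1)
      identity = solve-∀

    relation₄ : ev (mono Sign.+ 0 0 0) ≡ ev zero - ev (mono Sign.- 0 0 0)
    relation₄ = refl

    relation₅ : ev (mono Sign.- 0 0 0) ≡ ev (mono Sign.- 0 0 0) - ev zero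
    relation₅ = refl

    relation₆ : ev (mono Sign.+ 0 1 0) ≡ ev (mono Sign.- 1 0 0) - ev (mono Sign.- 0 0 1)
    relation₆ = identity α
      where
      identity : ∀ α → + 1 * (+ 1 * ((α - + 1) * + 1) * + 1) ≡
        - + 1 * ((α * + 1) * + 1 * + 1) - - + 1 * (+ 1 * + 1 * ((+ 2 * α - + 1) * + 1))
      identity = solve-∀

    relation₇ : ev zero ≡ ev (mono Sign.- 0 0 0) - ev (mono Sign.- 0 0 0)
    relation₇ = refl

    relation₈ : ev (mono Sign.- 0 1 0) ≡ ev (mono Sign.- 0 0 1) - ev (mono Sign.- 1 0 0)
    relation₈ = identity α
      where
      identity : ∀ α → - + 1 * (+ 1 * ((α - + 1) * + 1) * + 1) ≡
        - + 1 * (+ 1 * + 1 * ((+ 2 * α - + 1) * + 1)) - - + 1 * ((α * + 1) * + 1 * + 1)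
      identity = solve-∀

    relation₉ : ev zero ≡ ev zero - ev zero
    relation₉ = refl

  ev-cube : ∀ m → ev (m · m · m) ≡ ev m * ev m * ev m
  ev-cube m = trans (ev-· (m · m) m) (cong (_* ev m) (ev-· m m))

  ev-^ : ∀ m n → ev (m ^ᵐ n) ≡ ev m ^ n
  ev-^ m zero    = ev-1
  ev-^ m (suc n) = trans (ev-· m (m ^ᵐ n)) (cong (ev m *_) (ev-^ m n))

  -- A recurrence between large monomials reduces to a small relation between their cofactors once
  -- the common factor `m` is taken out.
  ev-combine : ∀ {t₀ t₁ t₂} m a₀ a₁ a₂ → t₀ ≡ m · a₀ → t₁ ≡ m · a₁ → t₂ ≡ m · a₂ → ev a₀ ≡ ev a₁ - ev a₂ →
    ev t₀ ≡ ev t₁ - ev t₂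
  ev-combine m a₀ a₁ a₂ refl refl refl eq = trans (ev-· m a₀) (trans (cong (ev m *_) eq)
    (trans (distrib (ev m) (ev a₁) (ev a₂)) (sym (cong₂ _-_ (ev-· m a₁) (ev-· m a₂)))))
    where
    distrib : ∀ x y z → x * (y - z) ≡ x * y - x * z
    distrib = solve-∀

  -- Quasi-periodicity and the recurrences

  H : ℕ → ℤ
  H n = ev (h-mono n)

  V : ℤ
  V = ev period

  -- The product of the factors `- V ^ (r + 8 i + 4)` over `i < l`, whose exponents add up to
  -- `4 l² + l r`.
  U : ℕ → ℕ → ℤ
  U l r = (- + 1) ^ l * V ^ (4 ℕ.* (l ℕ.* l) ℕ.+ l ℕ.* r)

  H-shift : ∀ n → H (8 ℕ.+ n) ≡ - (V ^ (n ℕ.+ 4)) * H n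
  H-shift n = trans (ev-· (mono Sign.- 0 0 0 · period ^ᵐ (n ℕ.+ 4)) (h-mono n))
    (cong (_* H n) (trans (ev-· (mono Sign.- 0 0 0) (period ^ᵐ (n ℕ.+ 4)))
      (trans (cong₂ _*_ ev-neg (ev-^ period (n ℕ.+ 4))) (ℤ.-1*i≡-i _))))

  -- The offset `r` need not be below 8, so the recurrences can use offsets such as `2 m` without
  -- carrying.
  H-periodic : ∀ l r → H (l ℕ.* 8 ℕ.+ r) ≡ U l r * H r
  H-periodic zero    r = sym (trans (ℤ.*-assoc (+ 1) (+ 1) (H r)) (trans (ℤ.*-identityˡ _) (ℤ.*-identityˡ _)))
  H-periodic (suc l) r = trans (H-shift (l ℕ.* 8 ℕ.+ r)) (trans (cong (- (V ^ (l ℕ.* 8 ℕ.+ r ℕ.+ 4)) *_) (H-periodic l r))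
    (trans (regroup (V ^ (l ℕ.* 8 ℕ.+ r ℕ.+ 4)) ((- + 1) ^ l) (V ^ (4 ℕ.* (l ℕ.* l) ℕ.+ l ℕ.* r)) (H r))
      (cong (λ x → (- + 1) ^ suc l * x * H r) (trans (sym (ℤ.^-distribˡ-+-* V (l ℕ.* 8 ℕ.+ r ℕ.+ 4) (4 ℕ.* (l ℕ.* l) ℕ.+ l ℕ.* r)))
        (cong (V ^_) (exponents l r))))))
    where
    regroup : ∀ v e w x → - v * (e * w * x) ≡ - + 1 * e * (v * w) * x
    regroup = solve-∀
    exponents : ∀ l r → l ℕ.* 8 ℕ.+ r ℕ.+ 4 ℕ.+ (4 ℕ.* (l ℕ.* l) ℕ.+ l ℕ.* r) ≡
      4 ℕ.* (suc l ℕ.* suc l) ℕ.+ suc l ℕ.* r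
    exponents = ℕ-Solver.solve-∀

  -- Both terms on the right of either recurrence are products of four values whose indices have the same sum.
  U-product : ∀ l {r₁ r₂ r₃ r₄ t} → r₁ ℕ.+ r₂ ℕ.+ r₃ ℕ.+ r₄ ≡ 2 ℕ.* t →
    U l r₁ * U l r₂ * U l r₃ * U l r₄ ≡ U (l ℕ.+ l) t
  U-product l {r₁} {r₂} {r₃} {r₄} {t} sum = begin
    U l r₁ * U l r₂ * U l r₃ * U l r₄
      ≡⟨ regroup ((- + 1) ^ l) (V ^ e r₁) (V ^ e r₂) (V ^ e r₃) (V ^ e r₄) ⟩
    (- + 1) ^ l * (- + 1) ^ l * ((- + 1) ^ l * (- + 1) ^ l) * (V ^ e r₁ * V ^ e r₂ * V ^ e r₃ * V ^ e r₄)
      ≡⟨ cong₂ _*_ signs powers ⟩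
    (- + 1) ^ (l ℕ.+ l) * V ^ (4 ℕ.* ((l ℕ.+ l) ℕ.* (l ℕ.+ l)) ℕ.+ (l ℕ.+ l) ℕ.* t) ∎
    where
    open ≡-Reasoning
    e : ℕ → ℕ
    e r = 4 ℕ.* (l ℕ.* l) ℕ.+ l ℕ.* r
    regroup : ∀ s a b c d → s * a * (s * b) * (s * c) * (s * d) ≡ s * s * (s * s) * (a * b * c * d)
    regroup = solve-∀
    squares : ∀ l → (- + 1) ^ l * (- + 1) ^ l ≡ + 1
    squares zero    = refl
    squares (suc l) = trans (regroup′ ((- + 1) ^ l)) (squares l)
      where
      regroup′ : ∀ x → - + 1 * x * (- + 1 * x) ≡ x * x
      regroup′ = solve-∀
    signs : (- + 1) ^ l * (- + 1) ^ l * ((- + 1) ^ l * (- + 1) ^ l) ≡ (- + 1) ^ (l ℕ.+ l)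
    signs = trans (cong₂ _*_ (squares l) (squares l)) (sym (trans (ℤ.^-distribˡ-+-* (- + 1) l l) (squares l)))
    exponents : ∀ l r₁ r₂ r₃ r₄ → 4 ℕ.* (l ℕ.* l) ℕ.+ l ℕ.* r₁ ℕ.+ (4 ℕ.* (l ℕ.* l) ℕ.+ l ℕ.* r₂) ℕ.+ (4 ℕ.* (l ℕ.* l) ℕ.+ l ℕ.* r₃) ℕ.+
      (4 ℕ.* (l ℕ.* l) ℕ.+ l ℕ.* r₄) ≡ 4 ℕ.* ((l ℕ.+ l) ℕ.* (l ℕ.+ l)) ℕ.+ l ℕ.* (r₁ ℕ.+ r₂ ℕ.+ r₃ ℕ.+ r₄)
    exponents = ℕ-Solver.solve-∀
    double : ∀ l t → l ℕ.* (2 ℕ.* t) ≡ (l ℕ.+ l) ℕ.* t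
    double = ℕ-Solver.solve-∀
    powers : V ^ e r₁ * V ^ e r₂ * V ^ e r₃ * V ^ e r₄ ≡ V ^ (4 ℕ.* ((l ℕ.+ l) ℕ.* (l ℕ.+ l)) ℕ.+ (l ℕ.+ l) ℕ.* t)
    powers = begin
      V ^ e r₁ * V ^ e r₂ * V ^ e r₃ * V ^ e r₄       ≡⟨ cong (λ x → x * V ^ e r₃ * V ^ e r₄) (ℤ.^-distribˡ-+-* V (e r₁) (e r₂)) ⟨
      V ^ (e r₁ ℕ.+ e r₂) * V ^ e r₃ * V ^ e r₄       ≡⟨ cong (_* V ^ e r₄) (ℤ.^-distribˡ-+-* V (e r₁ ℕ.+ e r₂) (e r₃)) ⟨
      V ^ (e r₁ ℕ.+ e r₂ ℕ.+ e r₃) * V ^ e r₄         ≡⟨ ℤ.^-distribˡ-+-* V (e r₁ ℕ.+ e r₂ ℕ.+ e r₃) (e r₄) ⟨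
      V ^ (e r₁ ℕ.+ e r₂ ℕ.+ e r₃ ℕ.+ e r₄)           ≡⟨ cong (V ^_) (exponents l r₁ r₂ r₃ r₄) ⟩
      V ^ (4 ℕ.* ((l ℕ.+ l) ℕ.* (l ℕ.+ l)) ℕ.+ l ℕ.* (r₁ ℕ.+ r₂ ℕ.+ r₃ ℕ.+ r₄))
        ≡⟨ cong (λ r → V ^ (4 ℕ.* ((l ℕ.+ l) ℕ.* (l ℕ.+ l)) ℕ.+ r)) (trans (cong (l ℕ.*_) sum) (double l t)) ⟩
      V ^ (4 ℕ.* ((l ℕ.+ l) ℕ.* (l ℕ.+ l)) ℕ.+ (l ℕ.+ l) ℕ.* t) ∎

  -- By quasi-periodicity eight consecutive values of `m = 2 + r` suffice. From `m = 6` to `m = 9`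
  -- one term contains the vanishing value at index 8, which explains the cofactor `zero`.
  odd-mono : ∀ r → r ℕ.< 8 → ev (h-mono (2 ℕ.* (2 ℕ.+ r) ℕ.+ 1)) ≡
    ev (h-mono (4 ℕ.+ r) · (h-mono (2 ℕ.+ r) · h-mono (2 ℕ.+ r) · h-mono (2 ℕ.+ r))) -
    ev (h-mono (1 ℕ.+ r) · (h-mono (3 ℕ.+ r) · h-mono (3 ℕ.+ r) · h-mono (3 ℕ.+ r)))
  odd-mono 0 _ = ev-combine (mono Sign.+ 23 9 9) (mono Sign.+ 0 1 0) (mono Sign.- 0 0 0) (mono Sign.- 1 0 0) refl refl refl relation₀
  odd-mono 1 _ = ev-combine (mono Sign.+ 45 19 18) (mono Sign.- 0 2 0) (mono Sign.- 2 0 0) (mono Sign.- 0 0 1) refl refl refl relation₁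
  odd-mono 2 _ = ev-combine (mono Sign.+ 75 33 30) (mono Sign.+ 0 2 0) (mono Sign.- 0 0 1) (mono Sign.- 2 0 0) refl refl refl relation₂
  odd-mono 3 _ = ev-combine (mono Sign.+ 113 51 45) (mono Sign.- 0 1 0) (mono Sign.- 1 0 0) (mono Sign.- 0 0 0) refl refl refl relation₃
  odd-mono 4 _ = ev-combine (mono Sign.+ 158 73 63) (mono Sign.+ 0 0 0) zero (mono Sign.- 0 0 0) refl refl refl relation₄
  odd-mono 5 _ = ev-combine (mono Sign.+ 210 98 84) (mono Sign.- 0 0 0) (mono Sign.- 0 0 0) zero refl refl refl relation₅
  odd-mono 6 _ = ev-combine (mono Sign.+ 270 126 108) (mono Sign.+ 0 0 0) zero (mono Sign.- 0 0 0) refl refl refl relation₄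
  odd-mono 7 _ = ev-combine (mono Sign.+ 338 157 135) (mono Sign.- 0 0 0) (mono Sign.- 0 0 0) zero refl refl refl relation₅
  odd-mono (suc (suc (suc (suc (suc (suc (suc (suc r)))))))) (ℕ.s≤s (ℕ.s≤s (ℕ.s≤s (ℕ.s≤s (ℕ.s≤s (ℕ.s≤s (ℕ.s≤s (ℕ.s≤s ()))))))))

  even-mono : ∀ r → r ℕ.< 8 → ev (h-mono 2 · h-mono (2 ℕ.* (3 ℕ.+ r))) ≡
    ev (h-mono (3 ℕ.+ r) · h-mono (5 ℕ.+ r) · (h-mono (2 ℕ.+ r) · h-mono (2 ℕ.+ r))) -
    ev (h-mono (3 ℕ.+ r) · h-mono (1 ℕ.+ r) · (h-mono (4 ℕ.+ r) · h-mono (4 ℕ.+ r)))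
  even-mono 0 _ = ev-combine (mono Sign.+ 36 15 14) (mono Sign.+ 0 1 0) (mono Sign.- 1 0 0) (mono Sign.- 0 0 1) refl refl refl relation₆
  even-mono 1 _ = ev-combine (mono Sign.+ 63 27 25) zero (mono Sign.- 0 0 0) (mono Sign.- 0 0 0) refl refl refl relation₇
  even-mono 2 _ = ev-combine (mono Sign.+ 96 43 38) (mono Sign.- 0 1 0) (mono Sign.- 0 0 1) (mono Sign.- 1 0 0) refl refl refl relation₈
  even-mono 3 _ = ev-combine (mono Sign.+ 137 63 55) (mono Sign.+ 0 0 0) zero (mono Sign.- 0 0 0) refl refl refl relation₄
  even-mono 4 _ = ev-combine (mono Sign.+ 186 86 74) (mono Sign.- 0 0 0) (mono Sign.- 0 0 0) zero refl refl refl relation₅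
  -- Here `m = 8`: all three terms vanish, and the common monomial is an arbitrary choice.
  even-mono 5 _ = ev-combine (mono Sign.+ 0 0 0) zero zero zero refl refl refl relation₉
  even-mono 6 _ = ev-combine (mono Sign.+ 306 142 122) (mono Sign.+ 0 0 0) zero (mono Sign.- 0 0 0) refl refl refl relation₄
  even-mono 7 _ = ev-combine (mono Sign.+ 377 175 151) (mono Sign.- 0 0 0) (mono Sign.- 0 0 0) zero refl refl refl relation₅
  even-mono (suc (suc (suc (suc (suc (suc (suc (suc r)))))))) (ℕ.s≤s (ℕ.s≤s (ℕ.s≤s (ℕ.s≤s (ℕ.s≤s (ℕ.s≤s (ℕ.s≤s (ℕ.s≤s ()))))))))

  odd-recurrence : ∀ l r → r ℕ.< 8 → H ((l ℕ.+ l) ℕ.* 8 ℕ.+ (2 ℕ.* (2 ℕ.+ r) ℕ.+ 1)) ≡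
    H (l ℕ.* 8 ℕ.+ (4 ℕ.+ r)) * H (l ℕ.* 8 ℕ.+ (2 ℕ.+ r)) ^ 3 - H (l ℕ.* 8 ℕ.+ (1 ℕ.+ r)) * H (l ℕ.* 8 ℕ.+ (3 ℕ.+ r)) ^ 3
  odd-recurrence l r r<8 = begin
    H ((l ℕ.+ l) ℕ.* 8 ℕ.+ (2 ℕ.* (2 ℕ.+ r) ℕ.+ 1))
      ≡⟨ H-periodic (l ℕ.+ l) (2 ℕ.* (2 ℕ.+ r) ℕ.+ 1) ⟩
    U (l ℕ.+ l) (2 ℕ.* (2 ℕ.+ r) ℕ.+ 1) * H (2 ℕ.* (2 ℕ.+ r) ℕ.+ 1)
      ≡⟨ cong (U (l ℕ.+ l) (2 ℕ.* (2 ℕ.+ r) ℕ.+ 1) *_) (trans (odd-mono r r<8) (cong₂ _-_ (expand 4 2) (expand 1 3))) ⟩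
    U (l ℕ.+ l) (2 ℕ.* (2 ℕ.+ r) ℕ.+ 1) * (h₄ * (h₂ * h₂ * h₂) - h₁ * (h₃ * h₃ * h₃))
      ≡⟨ distrib (U (l ℕ.+ l) (2 ℕ.* (2 ℕ.+ r) ℕ.+ 1)) (h₄ * (h₂ * h₂ * h₂)) (h₁ * (h₃ * h₃ * h₃)) ⟩
    U (l ℕ.+ l) (2 ℕ.* (2 ℕ.+ r) ℕ.+ 1) * (h₄ * (h₂ * h₂ * h₂)) - U (l ℕ.+ l) (2 ℕ.* (2 ℕ.+ r) ℕ.+ 1) * (h₁ * (h₃ * h₃ * h₃))
      ≡⟨ cong₂ (λ x y → x * (h₄ * (h₂ * h₂ * h₂)) - y * (h₁ * (h₃ * h₃ * h₃)))
           (U-product l {4 ℕ.+ r} {2 ℕ.+ r} {2 ℕ.+ r} {2 ℕ.+ r} (sum₁ r)) (U-product l {1 ℕ.+ r} {3 ℕ.+ r} {3 ℕ.+ r} {3 ℕ.+ r} (sum₂ r)) ⟨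
    U l (4 ℕ.+ r) * U l (2 ℕ.+ r) * U l (2 ℕ.+ r) * U l (2 ℕ.+ r) * (h₄ * (h₂ * h₂ * h₂)) -
    U l (1 ℕ.+ r) * U l (3 ℕ.+ r) * U l (3 ℕ.+ r) * U l (3 ℕ.+ r) * (h₁ * (h₃ * h₃ * h₃))
      ≡⟨ cong₂ _-_ (interchange (U l (4 ℕ.+ r)) (U l (2 ℕ.+ r)) h₄ h₂) (interchange (U l (1 ℕ.+ r)) (U l (3 ℕ.+ r)) h₁ h₃) ⟩
    U l (4 ℕ.+ r) * h₄ * (U l (2 ℕ.+ r) * h₂) ^ 3 - U l (1 ℕ.+ r) * h₁ * (U l (3 ℕ.+ r) * h₃) ^ 3
      ≡⟨ cong₂ _-_ (cong₂ (λ x y → x * y ^ 3) (H-periodic l (4 ℕ.+ r)) (H-periodic l (2 ℕ.+ r)))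
           (cong₂ (λ x y → x * y ^ 3) (H-periodic l (1 ℕ.+ r)) (H-periodic l (3 ℕ.+ r))) ⟨
    H (l ℕ.* 8 ℕ.+ (4 ℕ.+ r)) * H (l ℕ.* 8 ℕ.+ (2 ℕ.+ r)) ^ 3 - H (l ℕ.* 8 ℕ.+ (1 ℕ.+ r)) * H (l ℕ.* 8 ℕ.+ (3 ℕ.+ r)) ^ 3 ∎
    where
    open ≡-Reasoning
    h₁ h₂ h₃ h₄ : ℤ
    h₁ = H (1 ℕ.+ r)
    h₂ = H (2 ℕ.+ r)
    h₃ = H (3 ℕ.+ r)
    h₄ = H (4 ℕ.+ r)
    expand : ∀ i j → ev (h-mono (i ℕ.+ r) · (h-mono (j ℕ.+ r) · h-mono (j ℕ.+ r) · h-mono (j ℕ.+ r))) ≡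
      H (i ℕ.+ r) * (H (j ℕ.+ r) * H (j ℕ.+ r) * H (j ℕ.+ r))
    expand i j = trans (ev-· (h-mono (i ℕ.+ r)) _) (cong (H (i ℕ.+ r) *_) (ev-cube (h-mono (j ℕ.+ r))))
    distrib : ∀ x y z → x * (y - z) ≡ x * y - x * z
    distrib = solve-∀
    sum₁ : ∀ r → 4 ℕ.+ r ℕ.+ (2 ℕ.+ r) ℕ.+ (2 ℕ.+ r) ℕ.+ (2 ℕ.+ r) ≡ 2 ℕ.* (2 ℕ.* (2 ℕ.+ r) ℕ.+ 1)
    sum₁ = ℕ-Solver.solve-∀
    sum₂ : ∀ r → 1 ℕ.+ r ℕ.+ (3 ℕ.+ r) ℕ.+ (3 ℕ.+ r) ℕ.+ (3 ℕ.+ r) ≡ 2 ℕ.* (2 ℕ.* (2 ℕ.+ r) ℕ.+ 1)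
    sum₂ = ℕ-Solver.solve-∀
    interchange : ∀ u v x y → u * v * v * v * (x * (y * y * y)) ≡ u * x * (v * y * (v * y * (v * y * + 1)))
    interchange = solve-∀

  even-recurrence : ∀ l r → r ℕ.< 8 → H 2 * H ((l ℕ.+ l) ℕ.* 8 ℕ.+ 2 ℕ.* (3 ℕ.+ r)) ≡
    H (l ℕ.* 8 ℕ.+ (3 ℕ.+ r)) * (H (l ℕ.* 8 ℕ.+ (5 ℕ.+ r)) * H (l ℕ.* 8 ℕ.+ (2 ℕ.+ r)) ^ 2 -
      H (l ℕ.* 8 ℕ.+ (1 ℕ.+ r)) * H (l ℕ.* 8 ℕ.+ (4 ℕ.+ r)) ^ 2)
  even-recurrence l r r<8 = begin
    H 2 * H ((l ℕ.+ l) ℕ.* 8 ℕ.+ 2 ℕ.* (3 ℕ.+ r))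
      ≡⟨ cong (H 2 *_) (H-periodic (l ℕ.+ l) (2 ℕ.* (3 ℕ.+ r))) ⟩
    H 2 * (U (l ℕ.+ l) (2 ℕ.* (3 ℕ.+ r)) * H (2 ℕ.* (3 ℕ.+ r)))
      ≡⟨ swap (H 2) (U (l ℕ.+ l) (2 ℕ.* (3 ℕ.+ r))) (H (2 ℕ.* (3 ℕ.+ r))) ⟩
    U (l ℕ.+ l) (2 ℕ.* (3 ℕ.+ r)) * (H 2 * H (2 ℕ.* (3 ℕ.+ r)))
      ≡⟨ cong (U (l ℕ.+ l) (2 ℕ.* (3 ℕ.+ r)) *_)
           (trans (sym (ev-· (h-mono 2) (h-mono (2 ℕ.* (3 ℕ.+ r))))) (trans (even-mono r r<8) (cong₂ _-_ (expand 5 2) (expand 1 4)))) ⟩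
    U (l ℕ.+ l) (2 ℕ.* (3 ℕ.+ r)) * (h₃ * h₅ * (h₂ * h₂) - h₃ * h₁ * (h₄ * h₄))
      ≡⟨ distrib (U (l ℕ.+ l) (2 ℕ.* (3 ℕ.+ r))) (h₃ * h₅ * (h₂ * h₂)) (h₃ * h₁ * (h₄ * h₄)) ⟩
    U (l ℕ.+ l) (2 ℕ.* (3 ℕ.+ r)) * (h₃ * h₅ * (h₂ * h₂)) - U (l ℕ.+ l) (2 ℕ.* (3 ℕ.+ r)) * (h₃ * h₁ * (h₄ * h₄))
      ≡⟨ cong₂ (λ x y → x * (h₃ * h₅ * (h₂ * h₂)) - y * (h₃ * h₁ * (h₄ * h₄)))
           (U-product l {3 ℕ.+ r} {5 ℕ.+ r} {2 ℕ.+ r} {2 ℕ.+ r} (sum₁ r)) (U-product l {3 ℕ.+ r} {1 ℕ.+ r} {4 ℕ.+ r} {4 ℕ.+ r} (sum₂ r)) ⟨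
    U l (3 ℕ.+ r) * U l (5 ℕ.+ r) * U l (2 ℕ.+ r) * U l (2 ℕ.+ r) * (h₃ * h₅ * (h₂ * h₂)) -
    U l (3 ℕ.+ r) * U l (1 ℕ.+ r) * U l (4 ℕ.+ r) * U l (4 ℕ.+ r) * (h₃ * h₁ * (h₄ * h₄))
      ≡⟨ interchange (U l (1 ℕ.+ r)) (U l (2 ℕ.+ r)) (U l (3 ℕ.+ r)) (U l (4 ℕ.+ r)) (U l (5 ℕ.+ r)) h₁ h₂ h₃ h₄ h₅ ⟩
    U l (3 ℕ.+ r) * h₃ * (U l (5 ℕ.+ r) * h₅ * (U l (2 ℕ.+ r) * h₂) ^ 2 - U l (1 ℕ.+ r) * h₁ * (U l (4 ℕ.+ r) * h₄) ^ 2)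
      ≡⟨ cong₂ _*_ (H-periodic l (3 ℕ.+ r)) (cong₂ _-_ (cong₂ (λ x y → x * y ^ 2) (H-periodic l (5 ℕ.+ r)) (H-periodic l (2 ℕ.+ r)))
           (cong₂ (λ x y → x * y ^ 2) (H-periodic l (1 ℕ.+ r)) (H-periodic l (4 ℕ.+ r)))) ⟨
    H (l ℕ.* 8 ℕ.+ (3 ℕ.+ r)) * (H (l ℕ.* 8 ℕ.+ (5 ℕ.+ r)) * H (l ℕ.* 8 ℕ.+ (2 ℕ.+ r)) ^ 2 -
      H (l ℕ.* 8 ℕ.+ (1 ℕ.+ r)) * H (l ℕ.* 8 ℕ.+ (4 ℕ.+ r)) ^ 2) ∎
    where
    open ≡-Reasoning
    h₁ h₂ h₃ h₄ h₅ : ℤ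
    h₁ = H (1 ℕ.+ r)
    h₂ = H (2 ℕ.+ r)
    h₃ = H (3 ℕ.+ r)
    h₄ = H (4 ℕ.+ r)
    h₅ = H (5 ℕ.+ r)
    expand : ∀ i j → ev (h-mono (3 ℕ.+ r) · h-mono (i ℕ.+ r) · (h-mono (j ℕ.+ r) · h-mono (j ℕ.+ r))) ≡
      H (3 ℕ.+ r) * H (i ℕ.+ r) * (H (j ℕ.+ r) * H (j ℕ.+ r))
    expand i j = trans (ev-· (h-mono (3 ℕ.+ r) · h-mono (i ℕ.+ r)) _)
      (cong₂ _*_ (ev-· (h-mono (3 ℕ.+ r)) (h-mono (i ℕ.+ r))) (ev-· (h-mono (j ℕ.+ r)) (h-mono (j ℕ.+ r))))
    swap : ∀ x y z → x * (y * z) ≡ y * (x * z)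
    swap = solve-∀
    distrib : ∀ x y z → x * (y - z) ≡ x * y - x * z
    distrib = solve-∀
    sum₁ : ∀ r → 3 ℕ.+ r ℕ.+ (5 ℕ.+ r) ℕ.+ (2 ℕ.+ r) ℕ.+ (2 ℕ.+ r) ≡ 2 ℕ.* (2 ℕ.* (3 ℕ.+ r))
    sum₁ = ℕ-Solver.solve-∀
    sum₂ : ∀ r → 3 ℕ.+ r ℕ.+ (1 ℕ.+ r) ℕ.+ (4 ℕ.+ r) ℕ.+ (4 ℕ.+ r) ≡ 2 ℕ.* (2 ℕ.* (3 ℕ.+ r))
    sum₂ = ℕ-Solver.solve-∀
    interchange : ∀ u₁ u₂ u₃ u₄ u₅ x₁ x₂ x₃ x₄ x₅ →
      u₃ * u₅ * u₂ * u₂ * (x₃ * x₅ * (x₂ * x₂)) - u₃ * u₁ * u₄ * u₄ * (x₃ * x₁ * (x₄ * x₄)) ≡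
      u₃ * x₃ * (u₅ * x₅ * (u₂ * x₂ * (u₂ * x₂ * + 1)) - u₁ * x₁ * (u₄ * x₄ * (u₄ * x₄ * + 1)))
    interchange = solve-∀

  isH-H : IsH α H
  isH-H = record
    { h0 = ev-h₀ ; h1 = ev-1 ; h2 = ev-h₂ ; h3 = ev-h₃ ; h4 = ev-h₄ ; hodd = hodd ; heven = heven }
    where
    index : ∀ i l r → r ℕ.+ l ℕ.* 8 ℕ.+ i ≡ l ℕ.* 8 ℕ.+ (i ℕ.+ r)
    index = ℕ-Solver.solve-∀
    index₂ : ∀ i j l r → r ℕ.+ l ℕ.* 8 ℕ.+ i ℕ.+ j ≡ l ℕ.* 8 ℕ.+ (j ℕ.+ i ℕ.+ r)
    index₂ = ℕ-Solver.solve-∀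
    index-∸ : ∀ i j l r → r ℕ.+ l ℕ.* 8 ℕ.+ (i ℕ.+ j) ℕ.∸ j ≡ l ℕ.* 8 ℕ.+ (i ℕ.+ r)
    index-∸ i j l r = trans (cong (ℕ._∸ j) (sym (ℕ.+-assoc (r ℕ.+ l ℕ.* 8) i j)))
      (trans (ℕ.m+n∸n≡m (r ℕ.+ l ℕ.* 8 ℕ.+ i) j) (index i l r))
    index-odd : ∀ l r → 2 ℕ.* (r ℕ.+ l ℕ.* 8 ℕ.+ 2) ℕ.+ 1 ≡ (l ℕ.+ l) ℕ.* 8 ℕ.+ (2 ℕ.* (2 ℕ.+ r) ℕ.+ 1)
    index-odd = ℕ-Solver.solve-∀
    index-even : ∀ l r → 2 ℕ.* (r ℕ.+ l ℕ.* 8 ℕ.+ 3) ≡ (l ℕ.+ l) ℕ.* 8 ℕ.+ 2 ℕ.* (3 ℕ.+ r)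
    index-even = ℕ-Solver.solve-∀

    OddAt EvenAt : ℕ → Set
    OddAt k = let m = k ℕ.+ 2 in
      H (2 ℕ.* m ℕ.+ 1) ≡ H (m ℕ.+ 2) * (H m ^ 3) - H (m ℕ.∸ 1) * (H (m ℕ.+ 1) ^ 3)
    EvenAt k = let m = k ℕ.+ 3 in
      H 2 * H (2 ℕ.* m) ≡ H m * (H (m ℕ.+ 2) * (H (m ℕ.∸ 1) ^ 2) - H (m ℕ.∸ 2) * (H (m ℕ.+ 1) ^ 2))

    hodd : ∀ k → OddAt k
    hodd k = subst OddAt (sym (ℕ.m≡m%n+[m/n]*n k 8)) (at (k ℕ./ 8) (k % 8) (ℕ.m%n<n k 8))
      where
      at : ∀ l r → r ℕ.< 8 → OddAt (r ℕ.+ l ℕ.* 8)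
      at l r r<8 = trans (cong H (index-odd l r)) (trans (odd-recurrence l r r<8) (sym (cong₂ _-_
        (cong₂ (λ i j → H i * H j ^ 3) (index₂ 2 2 l r) (index 2 l r))
        (cong₂ (λ i j → H i * H j ^ 3) (index-∸ 1 1 l r) (index₂ 2 1 l r)))))

    heven : ∀ k → EvenAt k
    heven k = subst EvenAt (sym (ℕ.m≡m%n+[m/n]*n k 8)) (at (k ℕ./ 8) (k % 8) (ℕ.m%n<n k 8))
      where
      at : ∀ l r → r ℕ.< 8 → EvenAt (r ℕ.+ l ℕ.* 8)
      at l r r<8 = trans (cong (λ i → H 2 * H i) (index-even l r)) (trans (even-recurrence l r r<8) (sym (cong₂ _*_
        (cong H (index 3 l r)) (cong₂ _-_
          (cong₂ (λ i j → H i * H j ^ 2) (index₂ 3 2 l r) (index-∸ 2 1 l r))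
          (cong₂ (λ i j → H i * H j ^ 2) (index-∸ 1 2 l r) (index₂ 3 1 l r))))))

  -- For `l = 3 j` both exponents, `l` and `4 l² + l r`, are multiples of 3; hence the modulus 24.
  U-cube : ∀ j r → U (j ℕ.+ j ℕ.+ j) r ≡ (let c = (- + 1) ^ j * V ^ (12 ℕ.* (j ℕ.* j) ℕ.+ j ℕ.* r) in c * c * c)
  U-cube j r = begin
    (- + 1) ^ (j ℕ.+ j ℕ.+ j) * V ^ (4 ℕ.* ((j ℕ.+ j ℕ.+ j) ℕ.* (j ℕ.+ j ℕ.+ j)) ℕ.+ (j ℕ.+ j ℕ.+ j) ℕ.* r)
      ≡⟨ cong₂ _*_ (triple (- + 1) j) (trans (cong (V ^_) (exponents j r)) (triple V e)) ⟩
    (- + 1) ^ j * (- + 1) ^ j * (- + 1) ^ j * (V ^ e * V ^ e * V ^ e)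
      ≡⟨ interchange ((- + 1) ^ j) (V ^ e) ⟩
    (- + 1) ^ j * V ^ e * ((- + 1) ^ j * V ^ e) * ((- + 1) ^ j * V ^ e) ∎
    where
    open ≡-Reasoning
    e : ℕ
    e = 12 ℕ.* (j ℕ.* j) ℕ.+ j ℕ.* r
    triple : ∀ x n → x ^ (n ℕ.+ n ℕ.+ n) ≡ x ^ n * x ^ n * x ^ n
    triple x n = trans (ℤ.^-distribˡ-+-* x (n ℕ.+ n) n) (cong (_* x ^ n) (ℤ.^-distribˡ-+-* x n n))
    exponents : ∀ j r → 4 ℕ.* ((j ℕ.+ j ℕ.+ j) ℕ.* (j ℕ.+ j ℕ.+ j)) ℕ.+ (j ℕ.+ j ℕ.+ j) ℕ.* r ≡
      12 ℕ.* (j ℕ.* j) ℕ.+ j ℕ.* r ℕ.+ (12 ℕ.* (j ℕ.* j) ℕ.+ j ℕ.* r) ℕ.+ (12 ℕ.* (j ℕ.* j) ℕ.+ j ℕ.* r)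
    exponents = ℕ-Solver.solve-∀
    interchange : ∀ x y → x * x * x * (y * y * y) ≡ x * y * (x * y) * (x * y)
    interchange = solve-∀

-- Each recurrence expresses a value through smaller indices. The even one yields only
-- `h 2 * h (2 m)`, and cancelling `h 2` is where its being nonzero enters.
IsH-unique : ∀ {α h h′} → IsH α h → IsH α h′ → h 2 ≢ + 0 → ∀ n → h n ≡ h′ n
IsH-unique {α} {h} {h′} isH isH′ h₂≢0 = <-rec (λ n → h n ≡ h′ n) step
  where
  module ℎ = IsH isH
  module ℎ′ = IsH isH′

  halve : ∀ j → ∃[ k ] (j ≡ 2 ℕ.* k ⊎ j ≡ 2 ℕ.* k ℕ.+ 1)
  halve j = j ℕ./ 2 , cases (j % 2) (j ℕ./ 2) (ℕ.m%n<n j 2) (ℕ.m≡m%n+[m/n]*n j 2)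
    where
    cases : ∀ r k → r ℕ.< 2 → j ≡ r ℕ.+ k ℕ.* 2 → j ≡ 2 ℕ.* k ⊎ j ≡ 2 ℕ.* k ℕ.+ 1
    cases 0 k _ eq = inj₁ (trans eq (ℕ.*-comm k 2))
    cases 1 k _ eq = inj₂ (trans eq (trans (ℕ.+-comm 1 (k ℕ.* 2)) (cong (ℕ._+ 1) (ℕ.*-comm k 2))))
    cases (suc (suc _)) _ (ℕ.s≤s (ℕ.s≤s ()))

  below : ∀ {i n} d → n ≡ suc (i ℕ.+ d) → i ℕ.< n
  below {i} d n≡1+i+d = subst (i ℕ.<_) (sym n≡1+i+d) (ℕ.s≤s (ℕ.m≤m+n i d))

  odd-step : ∀ k → (∀ {i} → i ℕ.< 2 ℕ.* (k ℕ.+ 2) ℕ.+ 1 → h i ≡ h′ i) → h (2 ℕ.* (k ℕ.+ 2) ℕ.+ 1) ≡ h′ (2 ℕ.* (k ℕ.+ 2) ℕ.+ 1)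
  odd-step k rec = trans (ℎ.hodd k) (trans (cong₂ _-_
    (cong₂ (λ x y → x * y ^ 3) (rec (below k (gap₄ k))) (rec m<n))
    (cong₂ (λ x y → x * y ^ 3) (rec (ℕ.≤-<-trans (ℕ.m∸n≤m (k ℕ.+ 2) 1) m<n)) (rec (below (k ℕ.+ 1) (gap₃ k)))))
    (sym (ℎ′.hodd k)))
    where
    gap₂ : ∀ k → 2 ℕ.* (k ℕ.+ 2) ℕ.+ 1 ≡ suc (k ℕ.+ 2 ℕ.+ (k ℕ.+ 2))
    gap₂ = ℕ-Solver.solve-∀
    gap₃ : ∀ k → 2 ℕ.* (k ℕ.+ 2) ℕ.+ 1 ≡ suc (k ℕ.+ 2 ℕ.+ 1 ℕ.+ (k ℕ.+ 1))
    gap₃ = ℕ-Solver.solve-∀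
    gap₄ : ∀ k → 2 ℕ.* (k ℕ.+ 2) ℕ.+ 1 ≡ suc (k ℕ.+ 2 ℕ.+ 2 ℕ.+ k)
    gap₄ = ℕ-Solver.solve-∀
    m<n : k ℕ.+ 2 ℕ.< 2 ℕ.* (k ℕ.+ 2) ℕ.+ 1
    m<n = below (k ℕ.+ 2) (gap₂ k)

  even-step : ∀ k → (∀ {i} → i ℕ.< 2 ℕ.* (k ℕ.+ 3) → h i ≡ h′ i) → h (2 ℕ.* (k ℕ.+ 3)) ≡ h′ (2 ℕ.* (k ℕ.+ 3))
  even-step k rec = mult-cancelˡ (h 2) h₂≢0 (trans (ℎ.heven k) (trans (cong₂ _*_ (rec m<n) (cong₂ _-_
    (cong₂ (λ x y → x * y ^ 2) (rec (below k (gap₅ k))) (rec (ℕ.≤-<-trans (ℕ.m∸n≤m (k ℕ.+ 3) 1) m<n)))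
    (cong₂ (λ x y → x * y ^ 2) (rec (ℕ.≤-<-trans (ℕ.m∸n≤m (k ℕ.+ 3) 2) m<n)) (rec (below (k ℕ.+ 1) (gap₄ k))))))
    (trans (sym (ℎ′.heven k)) (cong (_* h′ (2 ℕ.* (k ℕ.+ 3))) (trans ℎ′.h2 (sym ℎ.h2))))))
    where
    gap₃ : ∀ k → 2 ℕ.* (k ℕ.+ 3) ≡ suc (k ℕ.+ 3 ℕ.+ (k ℕ.+ 2))
    gap₃ = ℕ-Solver.solve-∀
    gap₄ : ∀ k → 2 ℕ.* (k ℕ.+ 3) ≡ suc (k ℕ.+ 3 ℕ.+ 1 ℕ.+ (k ℕ.+ 1))
    gap₄ = ℕ-Solver.solve-∀
    gap₅ : ∀ k → 2 ℕ.* (k ℕ.+ 3) ≡ suc (k ℕ.+ 3 ℕ.+ 2 ℕ.+ k)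
    gap₅ = ℕ-Solver.solve-∀
    m<n : k ℕ.+ 3 ℕ.< 2 ℕ.* (k ℕ.+ 3)
    m<n = below (k ℕ.+ 2) (gap₃ k)

  step : ∀ n → (∀ {i} → i ℕ.< n → h i ≡ h′ i) → h n ≡ h′ n
  step 0 _ = trans ℎ.h0 (sym ℎ′.h0)
  step 1 _ = trans ℎ.h1 (sym ℎ′.h1)
  step 2 _ = trans ℎ.h2 (sym ℎ′.h2)
  step 3 _ = trans ℎ.h3 (sym ℎ′.h3)
  step 4 _ = trans ℎ.h4 (sym ℎ′.h4)
  step (suc (suc (suc (suc (suc j))))) rec = from-half (halve j)
    where
    odd-index : ∀ k → 5 ℕ.+ 2 ℕ.* k ≡ 2 ℕ.* (k ℕ.+ 2) ℕ.+ 1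
    odd-index = ℕ-Solver.solve-∀
    even-index : ∀ k → 5 ℕ.+ (2 ℕ.* k ℕ.+ 1) ≡ 2 ℕ.* (k ℕ.+ 3)
    even-index = ℕ-Solver.solve-∀
    Step : ℕ → Set
    Step n = (∀ {i} → i ℕ.< n → h i ≡ h′ i) → h n ≡ h′ n
    from-half : ∃[ k ] (j ≡ 2 ℕ.* k ⊎ j ≡ 2 ℕ.* k ℕ.+ 1) → h (5 ℕ.+ j) ≡ h′ (5 ℕ.+ j)
    from-half (k , inj₁ j≡2k)   = subst Step (sym (trans (cong (5 ℕ.+_) j≡2k) (odd-index k))) (odd-step k) rec
    from-half (k , inj₂ j≡2k+1) = subst Step (sym (trans (cong (5 ℕ.+_) j≡2k+1) (even-index k))) (even-step k) rec

-- `u x³ = u u² = u³` exhibits `u` as a quotient of cubes.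
square-is-cube : ∀ {u x} → u ≢ + 0 → u * u ≡ x * x * x → ∃[ t ] u ≡ t * t * t
square-is-cube {u} {x} u≢0 u²≡x³ = ℤ-cube-quotient {u} {x} {u} x≢0
  (trans (cong (u *_) (sym u²≡x³)) (sym (ℤ.*-assoc u u u)))
  where
  x≢0 : x ≢ + 0
  x≢0 refl = *-≢0 u≢0 u≢0 u²≡x³

-- Products of α, α - 1 and 2 α - 1 that are not cubes

module Cubes {α : ℤ} (α≢0 : α ≢ + 0) (α≢1 : α ≢ + 1) where

  α-1≢0 : α - + 1 ≢ + 0
  α-1≢0 eq = α≢1 (ℤ.i-j≡0⇒i≡j α (+ 1) eq)

  2α-1≢0 : + 2 * α - + 1 ≢ + 0
  2α-1≢0 = odd-≢0 {+ 2 * α - + 1} (α - + 1 , solve (α ∷ []))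

  -- `t³ - s³ = 1` has the factor `t - s`, which must be ± 1. For 1 it leaves `3 s (s + 1) = 0`,
  -- that is α = 1 or α = 0; for - 1 it leaves `3 (s² - s + 1) = 1`, impossible modulo 3.
  consecutive-not-cubes : ∀ {s t} → α ≡ t * t * t → α - + 1 ≡ s * s * s → ⊥
  consecutive-not-cubes {s} {t} α≡t³ α-1≡s³ = [ increasing , decreasing ]′
    (unit-±1 {t * t + t * s + s * s} {t - s} (linear₂ (- + 1) (+ 1) α≡t³ α-1≡s³ (solve (α ∷ s ∷ t ∷ []))))
    where
    increasing : t - s ≡ + 1 → ⊥
    increasing t-s≡1 = [ (λ s≡0 → α-1≢0 (trans α-1≡s³ (cong (λ s → s * s * s) s≡0)))
                       , (λ s+1≡0 → α≢0 (trans α≡t³ (cong (λ t → t * t * t) (trans t≡s+1 s+1≡0)))) ]′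
      (ℤ.i*j≡0⇒i≡0∨j≡0 s s[s+1]≡0)
      where
      t≡s+1 : t ≡ s + + 1
      t≡s+1 = linear (+ 1) t-s≡1 (solve (s ∷ t ∷ []))
      difference : (s + + 1) * (s + + 1) * (s + + 1) ≡ s * s * s + + 1
      difference = trans (cong (λ t → t * t * t) (sym t≡s+1)) (linear₂ (- + 1) (+ 1) α≡t³ α-1≡s³ (solve (α ∷ s ∷ t ∷ [])))
      s[s+1]≡0 : s * (s + + 1) ≡ + 0
      s[s+1]≡0 = mult-cancelˡ (+ 3) (λ ()) (linear (+ 1) difference (solve (s ∷ [])))

    decreasing : t - s ≡ - + 1 → ⊥
    decreasing t-s≡-1 = impossible (s * s - s + + 1) (linear (- + 1) difference (solve (s ∷ [])))
      where
      difference : (s - + 1) * (s - + 1) * (s - + 1) ≡ s * s * s + + 1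
      difference = trans (cong (λ t → t * t * t) (sym t≡s-1)) (linear₂ (- + 1) (+ 1) α≡t³ α-1≡s³ (solve (α ∷ s ∷ t ∷ [])))
        where
        t≡s-1 : t ≡ s - + 1
        t≡s-1 = linear (+ 1) t-s≡-1 (solve (s ∷ t ∷ []))
      impossible : ∀ m → + 3 * m ≢ + 1
      impossible (+ zero)         ()
      impossible (+ suc zero)     ()
      impossible (+ suc (suc m))  ()
      impossible -[1+ m ]         ()

  coprime-α² : Coprime (α * α) (α - + 1)
  coprime-α² = + 1 , - (α + + 1) , solve (α ∷ [])

  α²[α-1]-not-cube : ∀ {w} → α * α * (α - + 1) ≢ w * w * w
  α²[α-1]-not-cube {w} eq = combine
    (coprime-factor-of-ℤ-cube {α * α} {α - + 1} {w} (*-≢0 α≢0 α≢0) coprime-α² eq)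
    (coprime-factor-of-ℤ-cube {α - + 1} {α * α} {w} α-1≢0 (coprime-sym {α * α} coprime-α²) (trans (ℤ.*-comm (α - + 1) (α * α)) eq))
    where
    combine : ∃[ x ] α * α ≡ x * x * x → ∃[ s ] α - + 1 ≡ s * s * s → ⊥
    combine (x , α²≡x³) (s , α-1≡s³) =
      let t , α≡t³ = square-is-cube {α} {x} α≢0 α²≡x³ in consecutive-not-cubes {s} {t} α≡t³ α-1≡s³

  α²[α-1]²-not-cube : ∀ {w} → α * α * ((α - + 1) * (α - + 1)) ≢ w * w * w
  α²[α-1]²-not-cube {w} eq = combine
    (coprime-factor-of-ℤ-cube {α * α} {(α - + 1) * (α - + 1)} {w} (*-≢0 α≢0 α≢0) coprime eq)
    (coprime-factor-of-ℤ-cube {(α - + 1) * (α - + 1)} {α * α} {w} (*-≢0 α-1≢0 α-1≢0) (coprime-sym {α * α} coprime)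
      (trans (ℤ.*-comm ((α - + 1) * (α - + 1)) (α * α)) eq))
    where
    coprime : Coprime (α * α) ((α - + 1) * (α - + 1))
    coprime = coprime-* {α * α} {α - + 1} coprime-α² coprime-α²
    combine : ∃[ x ] α * α ≡ x * x * x → ∃[ y ] (α - + 1) * (α - + 1) ≡ y * y * y → ⊥
    combine (x , α²≡x³) (y , [α-1]²≡y³) =
      let t , α≡t³   = square-is-cube {α} {x} α≢0 α²≡x³
          s , α-1≡s³ = square-is-cube {α - + 1} {y} α-1≢0 [α-1]²≡y³
      in  consecutive-not-cubes {s} {t} α≡t³ α-1≡s³

  -- The difference of α - 1 and α is - 1 and their sum is 2 α - 1, so they are A and B of a descent step.
  [α-1][2α-1]-not-cube : ∀ {w} → (α - + 1) * (+ 2 * α - + 1) ≢ w * w * w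
  [α-1][2α-1]-not-cube {w} eq = no-solution (proj₁ (proj₂ (descent-step {α - + 1} {α} { - w} α-1≢0 α≢0
    (- + 1 , + 1 , solve (α ∷ [])) (α - + 1 , solve (α ∷ [])) (linear (- + 1) eq (solve (α ∷ w ∷ []))))))

  -- Reduction to the residues modulo 24

  open Evaluation α

  V≢0 : V ≢ + 0
  V≢0 = ev-≢0 α≢0 α-1≢0 2α-1≢0

  -- Along each residue class modulo 24 the value changes only by a nonzero cube.
  residue-is-cube : ∀ {h} → IsH α h → ∀ n → IsCube (h n) → ∃[ z ] H (n % 24) ≡ z * z * z
  residue-is-cube {h} isH n (β , _ , hn≡β³) = ℤ-cube-quotient {H (n % 24)} {c} {β} c≢0 (begin
    H (n % 24) * (c * c * c)                      ≡⟨ ℤ.*-comm (H (n % 24)) (c * c * c) ⟩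
    c * c * c * H (n % 24)                        ≡⟨ cong (_* H (n % 24)) (U-cube j (n % 24)) ⟨
    U (j ℕ.+ j ℕ.+ j) (n % 24) * H (n % 24)       ≡⟨ H-periodic (j ℕ.+ j ℕ.+ j) (n % 24) ⟨
    H ((j ℕ.+ j ℕ.+ j) ℕ.* 8 ℕ.+ n % 24)          ≡⟨ cong H (trans (index j (n % 24)) (sym (ℕ.m≡m%n+[m/n]*n n 24))) ⟩
    H n                                           ≡⟨ IsH-unique isH isH-H h₂≢0 n ⟨
    h n                                           ≡⟨ hn≡β³ ⟩
    β * (β * (β * + 1))                           ≡⟨ solve (β ∷ []) ⟩
    β * β * β                                     ∎)
    where
    open ≡-Reasoning
    j : ℕ
    j = n ℕ./ 24
    c : ℤ
    c = (- + 1) ^ j * V ^ (12 ℕ.* (j ℕ.* j) ℕ.+ j ℕ.* (n % 24))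
    c≢0 : c ≢ + 0
    c≢0 = *-≢0 (λ eq → contradiction (ℤ.i^n≡0⇒i≡0 (- + 1) j eq) (λ ()))
      (λ eq → V≢0 (ℤ.i^n≡0⇒i≡0 V (12 ℕ.* (j ℕ.* j) ℕ.+ j ℕ.* (n % 24)) eq))
    h₂≢0 : h 2 ≢ + 0
    h₂≢0 h₂≡0 = ev-≢0 α≢0 α-1≢0 2α-1≢0 (trans ev-h₂ (trans (sym (IsH.h2 isH)) h₂≡0))
    index : ∀ j r → (j ℕ.+ j ℕ.+ j) ℕ.* 8 ℕ.+ r ≡ r ℕ.+ j ℕ.* 24
    index = ℕ-Solver.solve-∀

  cofactor-is-cube : ∀ {t s a b c} r → let m = mono s a b c in t ≡ r · (m · m · m) → ∃[ z ] ev t ≡ z * z * z → ∃[ z ] ev r ≡ z * z * z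
  cofactor-is-cube {s = s} {a} {b} {c} r refl (z , eq) = ℤ-cube-quotient {ev r} {ev m} {z} (ev-≢0 α≢0 α-1≢0 2α-1≢0)
    (trans (cong (ev r *_) (sym (ev-cube m))) (trans (sym (ev-· r (m · m · m))) eq))
    where
    m : Mono
    m = mono s a b c

  not-[α-1][2α-1] : ¬ (∃[ z ] ev (mono Sign.+ 0 1 1) ≡ z * z * z)
  not-[α-1][2α-1] (z , eq) = [α-1][2α-1]-not-cube {z} (trans (sym ev-[α-1][2α-1]) eq)

  not-α²[α-1] : ¬ (∃[ z ] ev (mono Sign.+ 2 1 0) ≡ z * z * z)
  not-α²[α-1] (z , eq) = α²[α-1]-not-cube {z} (trans (sym ev-α²[α-1]) eq)

  not-α²[α-1]² : ¬ (∃[ z ] ev (mono Sign.+ 2 2 0) ≡ z * z * z)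
  not-α²[α-1]² (z , eq) = α²[α-1]²-not-cube {z} (trans (sym ev-α²[α-1]²) eq)

  -- The sign and exponents supplied are those of the root of a cube factor of `H r`; the exponents
  -- left over modulo 3 form the cofactor. Thus for `r = 5`, `α²³ (α - 1)¹⁰ (2 α - 1)⁹` is
  -- `α² (α - 1)` times the cube of `α⁷ (α - 1)³ (2 α - 1)³`.
  residues : ∀ {r} → r ∈ (2 ∷ 5 ∷ 10 ∷ 11 ∷ 12 ∷ 13 ∷ 14 ∷ 19 ∷ 22 ∷ []) → ¬ (∃[ z ] H r ≡ z * z * z)
  residues (here refl) = not-[α-1][2α-1] ∘ cofactor-is-cube {_} {Sign.-} {1} {0} {0} (mono Sign.+ 0 1 1) refl
  residues (there (here refl)) = not-α²[α-1] ∘ cofactor-is-cube {_} {Sign.+} {7} {3} {3} (mono Sign.+ 2 1 0) refl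
  residues (there (there (here refl))) = not-[α-1][2α-1] ∘ cofactor-is-cube {_} {Sign.+} {31} {14} {12} (mono Sign.+ 0 1 1) refl
  residues (there (there (there (here refl)))) = not-α²[α-1] ∘ cofactor-is-cube {_} {Sign.-} {37} {17} {15} (mono Sign.+ 2 1 0) refl
  residues (there (there (there (there (here refl))))) = not-α²[α-1]² ∘ cofactor-is-cube {_} {Sign.-} {44} {20} {18} (mono Sign.+ 2 2 0) refl
  residues (there (there (there (there (there (here refl)))))) = not-α²[α-1] ∘ cofactor-is-cube {_} {Sign.+} {52} {24} {21} (mono Sign.+ 2 1 0) refl
  residues (there (there (there (there (there (there (here refl))))))) = not-[α-1][2α-1] ∘ cofactor-is-cube {_} {Sign.+} {61} {28} {24} (mono Sign.+ 0 1 1) refl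
  residues (there (there (there (there (there (there (there (here refl)))))))) = not-α²[α-1] ∘ cofactor-is-cube {_} {Sign.-} {112} {52} {45} (mono Sign.+ 2 1 0) refl
  residues (there (there (there (there (there (there (there (there (here refl))))))))) = not-[α-1][2α-1] ∘ cofactor-is-cube {_} {Sign.-} {151} {70} {60} (mono Sign.+ 0 1 1) refl

theorem5p14 : (α : ℤ) → α ≢ + 0 → α ≢ + 1 → (h : ℕ → ℤ) → IsH α h →
    (n : ℕ) → n % 24 ∈ (2 ∷ 5 ∷ 10 ∷ 11 ∷ 12 ∷ 13 ∷ 14 ∷ 19 ∷ 22 ∷ []) →
    ¬ IsCube (h n)
theorem5p14 α α≢0 α≢1 h isH n n∈ cube = Cubes.residues α≢0 α≢1 n∈ (Cubes.residue-is-cube α≢0 α≢1 isH n cube)
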